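{- Let $q\ge 1$ and $n\ge 2$ be integers, let $X$ be a connected $(q+1)$-regular undirected graph with $n$ vertices and adjacency matrix $A$, and let $k\ge 1$ be an integer. Then the procedure $\mathrm{NGC}(A,k)$ (defined in the context) returns the number $N_k$ of geodesic cycles on $X$ of length $k$.
   Context: Geodesic cycles. Each edge of $X$ gives two oriented edges with opposite orientations. A walk of length $k$ is a sequence $(e_1,\dots,e_k)$ of oriented edges such that the end vertex of $e_i$ is the start vertex of $e_{i+1}$ for $1\le i\le k-1$. It is a cycle if the start vertex of $e_1$ is the end vertex of $e_k$. A walk has backtracking if $e_{i+1}$ is the oriented edge opposite to $e_i$ for some $1\le i\le k-1$; it is backtrackless otherwise. A cycle is geodesic if all its cyclically shifted cycles are backtrackless. $N_k$ is the number of geodesic cycles of length $k$ (as sequences of oriented edges). Procedure $\mathrm{Indices}(k)$ (integer $k\ge 1$). Start with the array $L=(k)$, indexed from $0$. While $k$ is even: set $k\leftarrow k/2$ and append $k$ to the end of $L$. Then, while $k\ne 1$: set $k\leftarrow (k+1)/2$; append $k$ to $L$; append $k-1$ to $L$; if $k$ is even, set $k\leftarrow k-1$. Return $L$. Procedure $\mathrm{NGC}(A,k)$. Let $n$ be the number of rows of $A$, $q=(\text{a row sum of }A)-1$, $L=\mathrm{Indices}(k)$, $l$ the length of $L$. Let $T[0..3]$ be an array of matrices with $T[0]\leftarrow A$ and $Q[0..3]$ an array of numbers with $Q[0]\leftarrow 1$ (other entries initially unspecified). For $i=l-1$ down to $1$ do: (a) for $j=3,2,1$ (in this order) set $Q[j]\leftarrow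 Q[j-1]$ and $T[j]\leftarrow T[j-1]$; (b) if $L[i-1]$ is even: put $j\leftarrow 1$ if $L[i-1]=2L[i]$ and $j\leftarrow 2$ otherwise; put $Q[0]\leftarrow Q[j]^2$ if $L[i+j-1]$ is even and $Q[0]\leftarrow q\,Q[j]^2$ otherwise; put $T[0]\leftarrow T[j]^2-2Q[0]I_n$, where $I_n$ is the identity matrix; (c) if $L[i-1]$ is odd: put $j\leftarrow 2$ if $L[i-1]=2L[i+1]-1$ and $j\leftarrow 1$ otherwise; put $Q[0]\leftarrow Q[j]Q[j+1]$; put $T[0]\leftarrow T[j]T[j+1]-Q[0]A$. After the loop: if $L[0]$ is odd return $\mathrm{trace}(T[0])$; otherwise return $n(q-1)+\mathrm{trace}(T[0])$. -}

module Defs where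

open import Data.Bool.Base using (Bool; true; false; not; if_then_else_)
open import Data.Fin.Base using (Fin; zero; suc; inject₁; fromℕ; toℕ)
open import Data.Fin.Properties using (all?; any?) renaming (_≟_ to _≟ᶠ_)
open import Data.Integer.Base using (ℤ; +_; 0ℤ; 1ℤ)
import Data.Integer.Base as ℤ
open import Data.Integer.Properties using () renaming (+-*-semiring to ℤ-semiring)
open import Data.List.Base using (List; []; _∷_; _∷ʳ_; length; filter; allFin; cartesianProduct; cartesianProductWith)
open import Data.Nat.Base using (ℕ; zero; suc; _+_; _*_; _∸_; _<_; NonZero; ⌊_/2⌋; ⌈_/2⌉)
open import Data.Nat.Divisibility using (_∣_; _∣?_)
open import Data.Nat.DivMod using (_mod_)
open import Data.Nat.Induction using (Acc; acc; <-wellFounded)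
open import Data.Nat.Properties using (_≟_; ≤-trans; n≤1+n; ⌊n/2⌋<n; ⌈n/2⌉<n)
open import Data.Product.Base using (∃-syntax; _×_; _,_; proj₁; proj₂)
open import Data.Product.Properties using (≡-dec)
open import Data.Vec.Functional as Vector using (Vector)
open import Relation.Binary.Construct.Closure.ReflexiveTransitive using (Star)
open import Relation.Binary.Definitions using (DecidableEquality)
open import Relation.Binary.PropositionalEquality using (_≡_)
open import Relation.Nullary using (¬_; Dec; does; ¬?; _×-dec_)
open import Algebra.Properties.Semiring.Sum ℤ-semiring using (sum)
import Data.Bool.Properties as Bool

------------------------------------------------------------------------
-- Integer matrices

Matrix : ℕ → Set
Matrix n = Vector (Vector ℤ n) n

module _ {n : ℕ} where

  infixl 7 _⊗_ _·_
  infixl 6 _⊖_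

  I : Matrix n
  I u v = if does (u ≟ᶠ v) then 1ℤ else 0ℤ

  _⊗_ : Matrix n → Matrix n → Matrix n
  (M ⊗ N) u v = sum λ w → M u w ℤ.* N w v

  _⊖_ : Matrix n → Matrix n → Matrix n
  (M ⊖ N) u v = M u v ℤ.- N u v

  _·_ : ℤ → Matrix n → Matrix n
  (c · M) u v = c ℤ.* M u v

  trace : Matrix n → ℤ
  trace M = sum λ u → M u u

------------------------------------------------------------------------
-- Graphs

-- Finite undirected graph on n vertices.  Loops and parallel edges are
-- allowed; the order in which `ends` lists the two endpoints of an edge
-- is immaterial, since both orientations are used below.
record Graph (n : ℕ) : Set where
  field
    #edges : ℕ
    ends   : Fin #edges → Fin n × Fin n

module _ {n : ℕ} (X : Graph n) where
  open Graph X

  -- (e , true) runs from the first endpoint of e to the second one,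
  -- (e , false) is the opposite oriented edge.
  OEdge : Set
  OEdge = Fin #edges × Bool

  start end : OEdge → Fin n
  start (e , true)  = proj₁ (ends e)
  start (e , false) = proj₂ (ends e)
  end   (e , true)  = proj₂ (ends e)
  end   (e , false) = proj₁ (ends e)

  opposite : OEdge → OEdge
  opposite (e , b) = e , not b

  _≟ᵒ_ : DecidableEquality OEdge
  _≟ᵒ_ = ≡-dec _≟ᶠ_ Bool._≟_

  orientedEdges : List OEdge
  orientedEdges = cartesianProduct (allFin #edges) (true ∷ false ∷ [])

  -- A loop contributes 2 to the degree of its vertex.
  degree : Fin n → ℕ
  degree v = length (filter (λ e → start e ≟ᶠ v) orientedEdges)

  Regular : ℕ → Set
  Regular d = ∀ v → degree v ≡ d

  Adjacent : Fin n → Fin n → Set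
  Adjacent u v = ∃[ e ] (start e ≡ u × end e ≡ v)

  Connected : Set
  Connected = ∀ u v → Star Adjacent u v

  -- Number of oriented edges from u to v: the usual 0/1 matrix if X is
  -- simple; in general parallel edges are counted with multiplicity and
  -- a loop contributes 2 to its diagonal entry.
  adjacency : Matrix n
  adjacency u v =
    + length (filter (λ e → (start e ≟ᶠ u) ×-dec (end e ≟ᶠ v)) orientedEdges)

  ----------------------------------------------------------------------
  -- Geodesic cycles; the length is suc m throughout.

  module _ {m : ℕ} where

    IsWalk : Vector OEdge (suc m) → Set
    IsWalk w = ∀ (i : Fin m) → end (w (inject₁ i)) ≡ start (w (suc i))

    IsCycle : Vector OEdge (suc m) → Set
    IsCycle w = IsWalk w × start (w zero) ≡ end (w (fromℕ m))

    HasBacktracking : Vector OEdge (suc m) → Set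
    HasBacktracking w = ∃[ i ] w (suc i) ≡ opposite (w (inject₁ i))

    Backtrackless : Vector OEdge (suc m) → Set
    Backtrackless w = ¬ HasBacktracking w

    cyclicShift : Fin (suc m) → Vector OEdge (suc m) → Vector OEdge (suc m)
    cyclicShift j w i = w ((toℕ j + toℕ i) mod suc m)

    IsGeodesicCycle : Vector OEdge (suc m) → Set
    IsGeodesicCycle w = IsCycle w × (∀ j → Backtrackless (cyclicShift j w))

    isGeodesicCycle? : ∀ w → Dec (IsGeodesicCycle w)
    isGeodesicCycle? w =
      (all? (λ i → end (w (inject₁ i)) ≟ᶠ start (w (suc i)))
        ×-dec (start (w zero) ≟ᶠ end (w (fromℕ m))))
      ×-dec all? (λ j → ¬? (any? (λ i →
        cyclicShift j w (suc i) ≟ᵒ opposite (cyclicShift j w (inject₁ i)))))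

  -- Every sequence of k oriented edges, each listed once.
  sequences : ∀ k → List (Vector OEdge k)
  sequences zero    = Vector.[] ∷ []
  sequences (suc k) = cartesianProductWith Vector._∷_ orientedEdges (sequences k)

  #geodesicCycles : (k : ℕ) → .{{NonZero k}} → ℕ
  #geodesicCycles (suc m) = length (filter isGeodesicCycle? (sequences (suc m)))

------------------------------------------------------------------------
-- The procedure Indices

even? : ∀ k → Dec (2 ∣ k)
even? k = 2 ∣? k

-- The two while loops, as functions of the current k and L; the first
-- also returns the final k.  The clauses for k = 0, where the loops would
-- not terminate, are never reached from k ≥ 1.
loop₁ : ∀ k → Acc _<_ k → List ℕ → ℕ × List ℕ
loop₁ zero        _        L = zero , L
loop₁ k@(suc k-1) (acc rs) L =
  if does (even? k)
    then loop₁ ⌊ k /2⌋ (rs (⌊n/2⌋<n k-1)) (L ∷ʳ ⌊ k /2⌋)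
    else (k , L)

-- ⌈ k /2⌉ is (k + 1) / 2, as k is odd here.
loop₂ : ∀ k → Acc _<_ k → List ℕ → List ℕ
loop₂ zero                _        L = L
loop₂ (suc zero)          _        L = L
loop₂ k@(suc (suc k-2)) (acc rs) L =
  if does (even? k′)
    then loop₂ (k′ ∸ 1) (rs (≤-trans (n≤1+n _) k′<k)) L′
    else loop₂ k′ (rs k′<k) L′
  where
  k′ = ⌈ k /2⌉
  L′ = L ∷ʳ k′ ∷ʳ (k′ ∸ 1)
  k′<k : k′ < k
  k′<k = ⌈n/2⌉<n k-2

Indices : ℕ → List ℕ
Indices k =
  let (k₁ , L) = loop₁ k (<-wellFounded k) (k ∷ [])
  in  loop₂ k₁ (<-wellFounded k₁) L

------------------------------------------------------------------------
-- The procedure NGC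

-- What the procedure leaves open: which row is used to compute q, the
-- initial contents of Q[1..3] and T[1..3], and the value of an
-- out-of-bounds read of L.
record Unspecified (n : ℕ) : Set where
  field
    row : Fin n
    Q₀  : Vector ℤ 3
    T₀  : Vector (Matrix n) 3
    oob : ℕ

at : {A : Set} → A → List A → ℕ → A
at d []       _       = d
at d (x ∷ xs) zero    = x
at d (x ∷ xs) (suc i) = at d xs i

-- x[j] ← x[j-1] for j = 3, 2, 1; the entry x[0] stays.
shift : {B : Set} → Vector B 4 → Vector B 4
shift x = Vector.head x Vector.∷ Vector.init x

set₀ : {B : Set} → B → Vector B 4 → Vector B 4
set₀ b x = b Vector.∷ Vector.tail x

record State (n : ℕ) : Set where
  constructor ⟨_,_⟩
  field
    Q : Vector ℤ 4
    T : Vector (Matrix n) 4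

module _ {n : ℕ} (A : Matrix n) (k : ℕ) (unspecified : Unspecified n) where
  open Unspecified unspecified

  q : ℤ
  q = sum (A row) ℤ.- 1ℤ

  L[_] : ℕ → ℕ
  L[ i ] = at oob (Indices k) i

  -- In `evenStep i`, `oddStep i` and `step i` the loop variable of the
  -- procedure is suc i, so L[ i ] is the entry just before its position.
  evenStep : ℕ → State n → State n
  evenStep i ⟨ Q , T ⟩ = ⟨ set₀ Q′ Q , set₀ (T j ⊗ T j ⊖ (+ 2 ℤ.* Q′) · I) T ⟩
    where
    j : Fin 4
    j = if does (L[ i ] ≟ 2 * L[ suc i ]) then suc zero else suc (suc zero)
    Q′ : ℤ
    Q′ = if does (even? L[ i + toℕ j ]) then Q j ℤ.* Q j else q ℤ.* (Q j ℤ.* Q j)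

  oddStep : ℕ → State n → State n
  oddStep i ⟨ Q , T ⟩ = ⟨ set₀ Q′ Q , set₀ (T j ⊗ T j+1 ⊖ Q′ · A) T ⟩
    where
    j′ : Fin 3
    j′ = if does (L[ i ] ≟ 2 * L[ 2 + i ] ∸ 1) then suc (suc zero) else suc zero
    j j+1 : Fin 4
    j   = inject₁ j′
    j+1 = suc j′
    Q′ : ℤ
    Q′ = Q j ℤ.* Q j+1

  step : ℕ → State n → State n
  step i ⟨ Q , T ⟩ =
    if does (even? L[ i ]) then evenStep i s else oddStep i s
    where
    s = ⟨ shift Q , shift T ⟩

  -- `run i` performs the iterations i, i - 1, …, 1.
  run : ℕ → State n → State n
  run zero    s = s
  run (suc i) s = run i (step i s)

  NGC : ℤ
  NGC =
    if does (even? L[ 0 ])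
      then + n ℤ.* (q ℤ.- 1ℤ) ℤ.+ trace (T zero)
      else trace (T zero)
    where
    open State (run (length (Indices k) ∸ 1) ⟨ 1ℤ Vector.∷ Q₀ , A Vector.∷ T₀ ⟩)

{-# OPTIONS --safe #-}

-- Let B be the non-backtracking matrix on the 2m oriented edges, so that
-- N_k = tr Bᵏ.  With the incidence matrices S (start) and E (end) and the
-- involution J of opposite edges, B = E S − J, S E = A and
-- S Sᵀ = S J E = (q + 1) I.  Expanding the powers of B gives, for the
-- matrices C_k = S Bᵏ E, both C_{k+2} = A C_{k+1} − q C_k and
-- N_{k+3} − N_{k+1} = tr C_{k+2} − q tr C_k.  The latter is
-- tr P_{k+3} − tr P_{k+1}, where P₀ = 2 I, P₁ = A and
-- P_{k+2} = P_{k+1} A − q P_k; so N_k is tr P_k for odd k and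
-- tr P_k + n (q − 1) for even k.  The procedure computes P_k by
-- P_{b+d} P_b = P_{2b+d} + q^b P_d with d = 0, 1, and its numbers Q are
-- the q^⌊x/2⌋ for the entries x of Indices k.
module Submission where

open import Defs
open import Data.Bool.Base using (Bool; true; false; if_then_else_)
open import Data.Bool.Properties using (if-cong)
import Data.Bool.Properties as Bool
open import Data.Fin.Base using (Fin; zero; suc; toℕ; inject₁; fromℕ; fromℕ<)
open import Data.Fin.Properties using (toℕ-injective; toℕ-fromℕ<; toℕ-inject₁; toℕ-fromℕ; toℕ<n) renaming (_≟_ to _≟ᶠ_)
open import Data.Integer.Base using (ℤ; +_; 0ℤ; 1ℤ)
import Data.Integer.Base as ℤ
import Data.Integer.Properties as ℤ
open import Data.Integer.Tactic.RingSolver using (solve-∀)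
open import Data.List.Base using (List; []; _∷_; _∷ʳ_; _++_; length; lookup; map; filter; allFin; tabulate; cartesianProductWith)
open import Data.List.Properties using (++-assoc; ++-identityʳ)
open import Data.Nat.Base using (ℕ; zero; suc; _+_; _*_; _∸_; _<_; _≤_; s≤s; s≤s⁻¹; z≤n; NonZero; ⌊_/2⌋; ⌈_/2⌉)
open import Data.Nat.DivMod using (_mod_; _%_; _/_; m%n<n; m≡m%n+[m/n]*n; [m+kn]%n≡m%n; m<n⇒m%n≡m; n%n≡0)
open import Data.Nat.Divisibility using (_∣_; m∣m*n; ∣m+n∣m⇒∣n; ∣1⇒≡1)
open import Data.Nat.Induction using (Acc; acc; <-wellFounded)
open import Data.Nat.Properties using (_≟_; _<?_; +-comm; +-suc; +-identityʳ; *-suc; *-cancelˡ-≡; ≤-antisym; ≤-trans; ≮⇒≥; <⇒≢; n≤1+n; m∸n≤m; 1+n≢n; m≢1+m+n; suc-injective; ⌊n/2⌋<n; ⌈n/2⌉<n; ⌊n/2⌋+⌈n/2⌉≡n)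
open import Data.Product.Base using (∃-syntax; _×_; _,_; proj₁; proj₂)
open import Data.Sum.Base using (_⊎_; inj₁; inj₂)
open import Data.Unit.Base using (⊤; tt)
open import Data.Vec.Functional as Vector using (Vector)
open import Function.Base using (_∘_)
open import Relation.Binary.PropositionalEquality using (_≡_; _≢_; refl; sym; trans; cong; cong₂; subst; subst₂; module ≡-Reasoning)
open import Relation.Nullary using (Dec; does; yes; no; ¬_; ¬?; contradiction; _×-dec_)
open import Relation.Nullary.Decidable using (dec-true; dec-false)
open import Algebra.Properties.Semiring.Sum ℤ.+-*-semiring using (sum; sum-cong-≗; ∑-distrib-+; ∑-comm; *-distribˡ-sum; *-distribʳ-sum)

open ≡-Reasoning


-- Expanding one factor B in tr Bᵏ⁺¹ leaves the extra trace tr (J Bᵏ). Expanding that one as well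
-- leads back to a trace of a power of B, since J J = 1, and what remains is reduced by J E = Sᵀ and
-- B Sᵀ = q E. So the trace recursion moves in steps of two, and the correction is constant on each
-- parity class. The first two lengths fix it: N₁ = tr A, while N₂ = tr A² - n (q + 1) exceeds tr P₂
-- = tr A² - 2 n q by n (q - 1). Everything is done over ℤ, by entrywise inductions in place of
-- eigenvalues.
--
-- In `Indices`, the second loop appends pairs a + 1, a. Apart from the last pair 2, 1, each even
-- member is twice a member of the pair appended next and each odd member is the sum of both. So
-- four array slots always contain the required factors, and the equality tests of the procedure
-- only find out how far away they are.

⟦_⟧ : {P : Set} → Dec P → ℤ
⟦ P? ⟧ = if does P? then 1ℤ else 0ℤ

⟦⟧-true : {P : Set} (P? : Dec P) → P → ⟦ P? ⟧ ≡ 1ℤ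
⟦⟧-true P? p = if-cong (dec-true P? p)

⟦⟧-false : {P : Set} (P? : Dec P) → ¬ P → ⟦ P? ⟧ ≡ 0ℤ
⟦⟧-false P? ¬p = if-cong (dec-false P? ¬p)

⟦⟧-⇔ : {P Q : Set} (P? : Dec P) (Q? : Dec Q) → (P → Q) → (Q → P) → ⟦ P? ⟧ ≡ ⟦ Q? ⟧
⟦⟧-⇔ (yes _) (yes _) _ _ = refl
⟦⟧-⇔ (yes p) (no ¬q) f _ = contradiction (f p) ¬q
⟦⟧-⇔ (no ¬p) (yes q) _ g = contradiction (g q) ¬p
⟦⟧-⇔ (no _)  (no _)  _ _ = refl

⟦⟧-× : {P Q : Set} (P? : Dec P) (Q? : Dec Q) → ⟦ P? ×-dec Q? ⟧ ≡ ⟦ P? ⟧ ℤ.* ⟦ Q? ⟧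
⟦⟧-× (yes _) (yes _) = refl
⟦⟧-× (yes _) (no _)  = refl
⟦⟧-× (no _)  (yes _) = refl
⟦⟧-× (no _)  (no _)  = refl

⟦⟧-subst : {A : Set} {x y : A} (x≟y : Dec (x ≡ y)) (f : A → ℤ) → ⟦ x≟y ⟧ ℤ.* f x ≡ ⟦ x≟y ⟧ ℤ.* f y
⟦⟧-subst (yes refl) f = refl
⟦⟧-subst (no _)     f = refl

-- Finite sums of integers

sum-0 : ∀ n → sum {n} (λ _ → 0ℤ) ≡ 0ℤ
sum-0 zero    = refl
sum-0 (suc n) = trans (ℤ.+-identityˡ _) (sum-0 n)

sum-const : ∀ n c → sum {n} (λ _ → c) ≡ + n ℤ.* c
sum-const zero    c = sym (ℤ.*-zeroˡ c)
sum-const (suc n) c = trans (cong (ℤ._+_ c) (sum-const n c)) (sym (ℤ.suc-* (+ n) c))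

sum-lin : ∀ {n} (f g : Fin n → ℤ) c → sum (λ i → f i ℤ.+ c ℤ.* g i) ≡ sum f ℤ.+ c ℤ.* sum g
sum-lin f g c = trans (∑-distrib-+ f _) (cong (ℤ._+_ (sum f)) (sym (*-distribˡ-sum c g)))

sum-⊖ : ∀ {n} (f g : Fin n → ℤ) → sum (λ i → f i ℤ.- g i) ≡ sum f ℤ.- sum g
sum-⊖ {zero}  f g = refl
sum-⊖ {suc n} f g = trans (cong (ℤ._+_ (f zero ℤ.- g zero)) (sum-⊖ (f ∘ suc) (g ∘ suc))) (lemma (f zero) (g zero) (sum (f ∘ suc)) (sum (g ∘ suc)))
  where
  lemma : ∀ a b c d → (a ℤ.- b) ℤ.+ (c ℤ.- d) ≡ (a ℤ.+ c) ℤ.- (b ℤ.+ d)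
  lemma = solve-∀

sum-δ : ∀ {n} (i : Fin n) (f : Fin n → ℤ) → sum (λ j → ⟦ i ≟ᶠ j ⟧ ℤ.* f j) ≡ f i
sum-δ {suc n} zero    f = begin
  1ℤ ℤ.* f zero ℤ.+ sum (λ j → 0ℤ ℤ.* f (suc j))  ≡⟨ cong₂ ℤ._+_ (ℤ.*-identityˡ (f zero)) (trans (sum-cong-≗ (λ j → ℤ.*-zeroˡ (f (suc j)))) (sum-0 n)) ⟩
  f zero ℤ.+ 0ℤ                                   ≡⟨ ℤ.+-identityʳ _ ⟩
  f zero                                          ∎
sum-δ {suc n} (suc i) f = begin
  0ℤ ℤ.* f zero ℤ.+ sum (λ j → ⟦ suc i ≟ᶠ suc j ⟧ ℤ.* f (suc j))  ≡⟨ cong₂ ℤ._+_ (ℤ.*-zeroˡ (f zero)) (sum-δ i (f ∘ suc)) ⟩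
  0ℤ ℤ.+ f (suc i)                                                 ≡⟨ ℤ.+-identityˡ _ ⟩
  f (suc i)                                                        ∎

sum-δ′ : ∀ {n} (i : Fin n) (f : Fin n → ℤ) → sum (λ j → ⟦ j ≟ᶠ i ⟧ ℤ.* f j) ≡ f i
sum-δ′ i f = trans (sum-cong-≗ (λ j → cong (ℤ._* f j) (⟦⟧-⇔ (j ≟ᶠ i) (i ≟ᶠ j) sym sym))) (sum-δ i f)

-- Matrices

infix 4 _≈_
-- Matrices are functions, so equality is taken entrywise, and congruence of products and traces has
-- to be supplied.
_≈_ : ∀ {n} → Matrix n → Matrix n → Set
M ≈ N = ∀ u v → M u v ≡ N u v

infixl 6 _⊕_
_⊕_ : ∀ {n} → Matrix n → Matrix n → Matrix n
(M ⊕ N) u v = M u v ℤ.+ N u v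

module _ {n : ℕ} where

  ⊗-cong : {M M′ N N′ : Matrix n} → M ≈ M′ → N ≈ N′ → M ⊗ N ≈ M′ ⊗ N′
  ⊗-cong M≈ N≈ u v = sum-cong-≗ λ w → cong₂ ℤ._*_ (M≈ u w) (N≈ w v)

  ⊗-congˡ : (M : Matrix n) {N N′ : Matrix n} → N ≈ N′ → M ⊗ N ≈ M ⊗ N′
  ⊗-congˡ M = ⊗-cong {M} (λ _ _ → refl)

  ⊗-congʳ : {M M′ : Matrix n} (N : Matrix n) → M ≈ M′ → M ⊗ N ≈ M′ ⊗ N
  ⊗-congʳ N M≈ = ⊗-cong {N = N} M≈ (λ _ _ → refl)

  ⊗-assoc : (M N K : Matrix n) → (M ⊗ N) ⊗ K ≈ M ⊗ (N ⊗ K)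
  ⊗-assoc M N K u v = begin
    sum (λ w → sum (λ x → M u x ℤ.* N x w) ℤ.* K w v)    ≡⟨ sum-cong-≗ (λ w → *-distribʳ-sum (K w v) (λ x → M u x ℤ.* N x w)) ⟩
    sum (λ w → sum (λ x → M u x ℤ.* N x w ℤ.* K w v))    ≡⟨ ∑-comm (λ w x → M u x ℤ.* N x w ℤ.* K w v) ⟩
    sum (λ x → sum (λ w → M u x ℤ.* N x w ℤ.* K w v))    ≡⟨ sum-cong-≗ (λ x → sum-cong-≗ (λ w → ℤ.*-assoc (M u x) (N x w) (K w v))) ⟩
    sum (λ x → sum (λ w → M u x ℤ.* (N x w ℤ.* K w v)))  ≡⟨ sum-cong-≗ (λ x → sym (*-distribˡ-sum (M u x) (λ w → N x w ℤ.* K w v))) ⟩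
    sum (λ x → M u x ℤ.* sum (λ w → N x w ℤ.* K w v))    ∎

  ⊗-linˡ : (M N K : Matrix n) (c : ℤ) → (M ⊕ c · N) ⊗ K ≈ M ⊗ K ⊕ c · (N ⊗ K)
  ⊗-linˡ M N K c u v = trans (sum-cong-≗ (λ w → lemma (M u w) (N u w) (K w v) c)) (sum-lin (λ w → M u w ℤ.* K w v) _ c)
    where
    lemma : ∀ x y z c → (x ℤ.+ c ℤ.* y) ℤ.* z ≡ x ℤ.* z ℤ.+ c ℤ.* (y ℤ.* z)
    lemma = solve-∀

  ⊗-linʳ : (M N K : Matrix n) (c : ℤ) → M ⊗ (N ⊕ c · K) ≈ M ⊗ N ⊕ c · (M ⊗ K)
  ⊗-linʳ M N K c u v = trans (sum-cong-≗ (λ w → lemma (M u w) (N w v) (K w v) c)) (sum-lin (λ w → M u w ℤ.* N w v) _ c)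
    where
    lemma : ∀ x y z c → x ℤ.* (y ℤ.+ c ℤ.* z) ≡ x ℤ.* y ℤ.+ c ℤ.* (x ℤ.* z)
    lemma = solve-∀

  ⊖-as-⊕ : (M N : Matrix n) (c : ℤ) → M ⊖ c · N ≈ M ⊕ (ℤ.- c) · N
  ⊖-as-⊕ M N c u v = cong (ℤ._+_ (M u v)) (ℤ.neg-distribˡ-* c (N u v))

  ⊗-linˡ⁻ : (M N K : Matrix n) (c : ℤ) → (M ⊖ c · N) ⊗ K ≈ M ⊗ K ⊖ c · (N ⊗ K)
  ⊗-linˡ⁻ M N K c u v = begin
    ((M ⊖ c · N) ⊗ K) u v          ≡⟨ ⊗-congʳ K (⊖-as-⊕ M N c) u v ⟩
    ((M ⊕ (ℤ.- c) · N) ⊗ K) u v    ≡⟨ ⊗-linˡ M N K (ℤ.- c) u v ⟩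
    (M ⊗ K ⊕ (ℤ.- c) · (N ⊗ K)) u v ≡⟨ ⊖-as-⊕ (M ⊗ K) (N ⊗ K) c u v ⟨
    (M ⊗ K ⊖ c · (N ⊗ K)) u v      ∎

  ⊗-linʳ⁻ : (M N K : Matrix n) (c : ℤ) → M ⊗ (N ⊖ c · K) ≈ M ⊗ N ⊖ c · (M ⊗ K)
  ⊗-linʳ⁻ M N K c u v = begin
    (M ⊗ (N ⊖ c · K)) u v          ≡⟨ ⊗-congˡ M (⊖-as-⊕ N K c) u v ⟩
    (M ⊗ (N ⊕ (ℤ.- c) · K)) u v    ≡⟨ ⊗-linʳ M N K (ℤ.- c) u v ⟩
    (M ⊗ N ⊕ (ℤ.- c) · (M ⊗ K)) u v ≡⟨ ⊖-as-⊕ (M ⊗ N) (M ⊗ K) c u v ⟨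
    (M ⊗ N ⊖ c · (M ⊗ K)) u v      ∎

  ⊗-·I : (M : Matrix n) (c : ℤ) → M ⊗ (c · I) ≈ c · M
  ⊗-·I M c u v = trans (sum-cong-≗ (λ w → lemma (M u w) ⟦ w ≟ᶠ v ⟧ c)) (sum-δ′ v (λ w → c ℤ.* M u w))
    where
    lemma : ∀ m i c → m ℤ.* (c ℤ.* i) ≡ i ℤ.* (c ℤ.* m)
    lemma = solve-∀

  ·I-⊗ : (M : Matrix n) (c : ℤ) → (c · I) ⊗ M ≈ c · M
  ·I-⊗ M c u v = trans (sum-cong-≗ (λ w → lemma (M w v) ⟦ u ≟ᶠ w ⟧ c)) (sum-δ u (λ w → c ℤ.* M w v))
    where
    lemma : ∀ m i c → (c ℤ.* i) ℤ.* m ≡ i ℤ.* (c ℤ.* m)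
    lemma = solve-∀

  trace-cong : {M N : Matrix n} → M ≈ N → trace M ≡ trace N
  trace-cong M≈N = sum-cong-≗ λ u → M≈N u u

  trace-·I : (c : ℤ) → trace (c · I {n}) ≡ + n ℤ.* c
  trace-·I c = trans (sum-cong-≗ λ (u : Fin n) → trans (cong (c ℤ.*_) (⟦⟧-true (u ≟ᶠ u) refl)) (ℤ.*-identityʳ c)) (sum-const n c)

-- Dickson polynomials of a matrix

-- With A = α + β and α β = q this is αᵏ + βᵏ.
module _ {n : ℕ} (A : Matrix n) (q : ℤ) where

  P : ℕ → Matrix n
  P 0             = + 2 · I
  P 1             = A
  P (suc (suc k)) = P (suc k) ⊗ A ⊖ q · P k

  -- The mixed terms of (αᵇ⁺ᵈ + βᵇ⁺ᵈ) (αᵇ + βᵇ) are (α β)ᵇ (αᵈ + βᵈ). The induction lowers b and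
  -- raises d; the case b = 1 is the defining recursion. The equations for `a` and `s` let callers
  -- keep their own form of the indices.
  P⊗P : ∀ b d {a s} → a ≡ b + d → s ≡ b + a → P a ⊗ P b ≈ P s ⊕ (q ℤ.^ b) · P d
  P⊗P zero d refl refl u v = trans (⊗-·I (P d) (+ 2) u v) (lemma (P d u v))
    where
    lemma : ∀ x → + 2 ℤ.* x ≡ x ℤ.+ 1ℤ ℤ.* x
    lemma = solve-∀
  P⊗P (suc zero) d refl refl u v = lemma ((P (suc d) ⊗ A) u v) q (P d u v)
    where
    lemma : ∀ x q y → x ≡ x ℤ.- q ℤ.* y ℤ.+ (q ℤ.* 1ℤ) ℤ.* y
    lemma = solve-∀
  P⊗P (suc (suc b)) d {s = suc (suc s)} refl refl u v = begin
    (P a ⊗ (P (suc b) ⊗ A ⊖ q · P b)) u v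
      ≡⟨ ⊗-linʳ⁻ (P a) (P (suc b) ⊗ A) (P b) q u v ⟩
    (P a ⊗ (P (suc b) ⊗ A)) u v ℤ.- q ℤ.* (P a ⊗ P b) u v
      -- The same `P a` serves both induction hypotheses, with `suc d` and `2 + d` in the place of
      -- `d`.
      ≡⟨ cong₂ (λ x y → x ℤ.- q ℤ.* y) (P⊗P⊗A (P⊗P (suc b) (suc d) (cong suc (sym (+-suc b d))) refl)) (P⊗P b (2 + d) (sym (trans (+-suc b (suc d)) (cong suc (+-suc b d)))) refl u v) ⟩
    (P (suc s) ⊗ A) u v ℤ.+ (q ℤ.* q ℤ.^ b) ℤ.* (P (suc d) ⊗ A) u v ℤ.- q ℤ.* (P s u v ℤ.+ (q ℤ.^ b) ℤ.* ((P (suc d) ⊗ A) u v ℤ.- q ℤ.* P d u v))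
      ≡⟨ lemma ((P (suc s) ⊗ A) u v) ((P (suc d) ⊗ A) u v) (P s u v) (P d u v) q (q ℤ.^ b) ⟩
    ((P (suc s) ⊗ A) u v ℤ.- q ℤ.* P s u v) ℤ.+ (q ℤ.* (q ℤ.* q ℤ.^ b)) ℤ.* P d u v
      ∎
    where
    a = 2 + (b + d)
    c = q ℤ.* q ℤ.^ b
    P⊗P⊗A : P a ⊗ P (suc b) ≈ P (suc s) ⊕ c · P (suc d) → (P a ⊗ (P (suc b) ⊗ A)) u v ≡ (P (suc s) ⊗ A) u v ℤ.+ c ℤ.* (P (suc d) ⊗ A) u v
    P⊗P⊗A IH = begin
      (P a ⊗ (P (suc b) ⊗ A)) u v  ≡⟨ ⊗-assoc (P a) (P (suc b)) A u v ⟨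
      ((P a ⊗ P (suc b)) ⊗ A) u v  ≡⟨ ⊗-congʳ A IH u v ⟩
      ((P (suc s) ⊕ c · P (suc d)) ⊗ A) u v ≡⟨ ⊗-linˡ (P (suc s)) (P (suc d)) A c u v ⟩
      (P (suc s) ⊗ A) u v ℤ.+ c ℤ.* (P (suc d) ⊗ A) u v ∎
    lemma : ∀ x y z w q r → x ℤ.+ (q ℤ.* r) ℤ.* y ℤ.- q ℤ.* (z ℤ.+ r ℤ.* (y ℤ.- q ℤ.* w)) ≡ (x ℤ.- q ℤ.* z) ℤ.+ (q ℤ.* (q ℤ.* r)) ℤ.* w
    lemma = solve-∀

  -- `P k` is a polynomial in A and commutes with it. The definition multiplies on the right, as
  -- `P⊗P` requires, whereas the recursion of the walk matrices multiplies on the left.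
  P-recˡ : ∀ k → P (2 + k) ≈ A ⊗ P (1 + k) ⊖ q · P k
  P-recˡ zero          u v = refl
  P-recˡ (suc zero)    u v = cong (ℤ._- q ℤ.* A u v) (begin
    ((A ⊗ A ⊖ q · P 0) ⊗ A) u v                         ≡⟨ ⊗-linˡ⁻ (A ⊗ A) (P 0) A q u v ⟩
    ((A ⊗ A) ⊗ A) u v ℤ.- q ℤ.* (P 0 ⊗ A) u v           ≡⟨ cong₂ (λ x y → x ℤ.- q ℤ.* y) (⊗-assoc A A A u v) (trans (·I-⊗ A (+ 2) u v) (sym (⊗-·I A (+ 2) u v))) ⟩
    (A ⊗ (A ⊗ A)) u v ℤ.- q ℤ.* (A ⊗ P 0) u v           ≡⟨ ⊗-linʳ⁻ A (A ⊗ A) (P 0) q u v ⟨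
    (A ⊗ (A ⊗ A ⊖ q · P 0)) u v                         ∎)
  P-recˡ (suc (suc k)) u v = begin
    (P (3 + k) ⊗ A) u v ℤ.- q ℤ.* P (2 + k) u v
      ≡⟨ cong₂ (λ x y → x ℤ.- q ℤ.* y) (trans (⊗-congʳ A (P-recˡ (suc k)) u v) (⊗-linˡ⁻ (A ⊗ P (2 + k)) (P (1 + k)) A q u v)) (P-recˡ k u v) ⟩
    ((A ⊗ P (2 + k)) ⊗ A) u v ℤ.- q ℤ.* (P (1 + k) ⊗ A) u v ℤ.- q ℤ.* ((A ⊗ P (1 + k)) u v ℤ.- q ℤ.* P k u v)
      ≡⟨ cong (λ x → x ℤ.- q ℤ.* (P (1 + k) ⊗ A) u v ℤ.- q ℤ.* ((A ⊗ P (1 + k)) u v ℤ.- q ℤ.* P k u v)) (⊗-assoc A (P (2 + k)) A u v) ⟩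
    (A ⊗ (P (2 + k) ⊗ A)) u v ℤ.- q ℤ.* (P (1 + k) ⊗ A) u v ℤ.- q ℤ.* ((A ⊗ P (1 + k)) u v ℤ.- q ℤ.* P k u v)
      ≡⟨ lemma ((A ⊗ (P (2 + k) ⊗ A)) u v) ((P (1 + k) ⊗ A) u v) ((A ⊗ P (1 + k)) u v) (P k u v) q ⟩
    ((A ⊗ (P (2 + k) ⊗ A)) u v ℤ.- q ℤ.* (A ⊗ P (1 + k)) u v) ℤ.- q ℤ.* ((P (1 + k) ⊗ A) u v ℤ.- q ℤ.* P k u v)
      ≡⟨ cong (ℤ._- q ℤ.* P (2 + k) u v) (⊗-linʳ⁻ A (P (2 + k) ⊗ A) (P (1 + k)) q u v) ⟨
    (A ⊗ P (3 + k)) u v ℤ.- q ℤ.* P (2 + k) u v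
      ∎
    where
    lemma : ∀ x y z w q → (x ℤ.- q ℤ.* y) ℤ.- q ℤ.* (z ℤ.- q ℤ.* w) ≡ (x ℤ.- q ℤ.* z) ℤ.- q ℤ.* (y ℤ.- q ℤ.* w)
    lemma = solve-∀

  -- The generating functions of C and P are rational with the common
  -- denominator 1 − A t + q t², which turns one recursion into the other.
  C-via-P : (C : ℕ → Matrix n) →
            C 0 ≈ A → C 1 ≈ A ⊗ A ⊖ (q ℤ.+ 1ℤ) · I →
            (∀ k → C (2 + k) ≈ A ⊗ C (1 + k) ⊖ q · C k) →
            ∀ k → C (2 + k) ≈ P (3 + k) ⊖ P (1 + k) ⊕ q · C k
  C-via-P C C₀ C₁ C-rec zero u v = begin
    C 2 u v
      ≡⟨ C-rec 0 u v ⟩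
    (A ⊗ C 1) u v ℤ.- q ℤ.* C 0 u v
      ≡⟨ cong (ℤ._- q ℤ.* C 0 u v) (trans (⊗-congˡ A C₁ u v) (trans (⊗-linʳ⁻ A (A ⊗ A) I (q ℤ.+ 1ℤ) u v) (cong (λ x → (A ⊗ (A ⊗ A)) u v ℤ.- (q ℤ.+ 1ℤ) ℤ.* x) A⊗I))) ⟩
    (A ⊗ (A ⊗ A)) u v ℤ.- (q ℤ.+ 1ℤ) ℤ.* A u v ℤ.- q ℤ.* C 0 u v
      ≡⟨ cong (λ x → (A ⊗ (A ⊗ A)) u v ℤ.- (q ℤ.+ 1ℤ) ℤ.* A u v ℤ.- q ℤ.* x) (C₀ u v) ⟩
    (A ⊗ (A ⊗ A)) u v ℤ.- (q ℤ.+ 1ℤ) ℤ.* A u v ℤ.- q ℤ.* A u v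
      ≡⟨ lemma ((A ⊗ (A ⊗ A)) u v) (A u v) q ⟩
    ((A ⊗ (A ⊗ A)) u v ℤ.- q ℤ.* (+ 2 ℤ.* A u v)) ℤ.- q ℤ.* A u v ℤ.- A u v ℤ.+ q ℤ.* A u v
      ≡⟨ cong (λ x → x ℤ.- q ℤ.* A u v ℤ.- A u v ℤ.+ q ℤ.* A u v) A⊗P2 ⟨
    (A ⊗ P 2) u v ℤ.- q ℤ.* A u v ℤ.- A u v ℤ.+ q ℤ.* A u v
      ≡⟨ cong₂ (λ x y → x ℤ.- A u v ℤ.+ q ℤ.* y) (P-recˡ 1 u v) (C₀ u v) ⟨
    P 3 u v ℤ.- A u v ℤ.+ q ℤ.* C 0 u v
      ∎
    where
    A⊗I : (A ⊗ I) u v ≡ A u v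
    A⊗I = trans (⊗-congˡ A (λ u v → sym (ℤ.*-identityˡ (I u v))) u v) (trans (⊗-·I A 1ℤ u v) (ℤ.*-identityˡ _))
    A⊗P2 : (A ⊗ P 2) u v ≡ (A ⊗ (A ⊗ A)) u v ℤ.- q ℤ.* (+ 2 ℤ.* A u v)
    A⊗P2 = trans (⊗-linʳ⁻ A (A ⊗ A) (P 0) q u v) (cong (λ x → (A ⊗ (A ⊗ A)) u v ℤ.- q ℤ.* x) (⊗-·I A (+ 2) u v))
    lemma : ∀ x y q → x ℤ.- (q ℤ.+ 1ℤ) ℤ.* y ℤ.- q ℤ.* y ≡ (x ℤ.- q ℤ.* (+ 2 ℤ.* y)) ℤ.- q ℤ.* y ℤ.- y ℤ.+ q ℤ.* y
    lemma = solve-∀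
  C-via-P C C₀ C₁ C-rec (suc k) u v = begin
    C (3 + k) u v
      ≡⟨ C-rec (suc k) u v ⟩
    (A ⊗ C (2 + k)) u v ℤ.- q ℤ.* C (1 + k) u v
      ≡⟨ cong (ℤ._- q ℤ.* C (1 + k) u v) A⊗C ⟩
    (A ⊗ P (3 + k)) u v ℤ.- (A ⊗ P (1 + k)) u v ℤ.+ q ℤ.* (A ⊗ C k) u v ℤ.- q ℤ.* C (1 + k) u v
      ≡⟨ rest k ⟩
    P (4 + k) u v ℤ.- P (2 + k) u v ℤ.+ q ℤ.* C (1 + k) u v
      ∎
    where
    A⊗C : (A ⊗ C (2 + k)) u v ≡ (A ⊗ P (3 + k)) u v ℤ.- (A ⊗ P (1 + k)) u v ℤ.+ q ℤ.* (A ⊗ C k) u v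
    A⊗C = begin
      (A ⊗ C (2 + k)) u v
        ≡⟨ ⊗-congˡ A (C-via-P C C₀ C₁ C-rec k) u v ⟩
      (A ⊗ (P (3 + k) ⊖ P (1 + k) ⊕ q · C k)) u v
        ≡⟨ ⊗-linʳ A (P (3 + k) ⊖ P (1 + k)) (C k) q u v ⟩
      (A ⊗ (P (3 + k) ⊖ P (1 + k))) u v ℤ.+ q ℤ.* (A ⊗ C k) u v
        ≡⟨ cong (ℤ._+ q ℤ.* (A ⊗ C k) u v) (trans (sum-cong-≗ (λ w → ℤ-distrib (A u w) (P (3 + k) w v) (P (1 + k) w v))) (sum-⊖ (λ w → A u w ℤ.* P (3 + k) w v) _)) ⟩
      (A ⊗ P (3 + k)) u v ℤ.- (A ⊗ P (1 + k)) u v ℤ.+ q ℤ.* (A ⊗ C k) u v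
        ∎
      where
      ℤ-distrib : ∀ x y z → x ℤ.* (y ℤ.- z) ≡ x ℤ.* y ℤ.- x ℤ.* z
      ℤ-distrib = solve-∀
    rest : ∀ k → (A ⊗ P (3 + k)) u v ℤ.- (A ⊗ P (1 + k)) u v ℤ.+ q ℤ.* (A ⊗ C k) u v ℤ.- q ℤ.* C (1 + k) u v
               ≡ P (4 + k) u v ℤ.- P (2 + k) u v ℤ.+ q ℤ.* C (1 + k) u v
    -- No earlier instance of the identity covers `C 1`: one index further back it would involve (q
    -- + 1) / q times `I`, so `C₀` and `C₁` are substituted instead.
    rest zero = begin
      (A ⊗ P 3) u v ℤ.- (A ⊗ A) u v ℤ.+ q ℤ.* (A ⊗ C 0) u v ℤ.- q ℤ.* C 1 u v
        ≡⟨ cong₂ (λ x y → (A ⊗ P 3) u v ℤ.- (A ⊗ A) u v ℤ.+ q ℤ.* x ℤ.- q ℤ.* y) (⊗-congˡ A C₀ u v) (C₁ u v) ⟩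
      (A ⊗ P 3) u v ℤ.- (A ⊗ A) u v ℤ.+ q ℤ.* (A ⊗ A) u v ℤ.- q ℤ.* ((A ⊗ A) u v ℤ.- (q ℤ.+ 1ℤ) ℤ.* I u v)
        ≡⟨ lemma ((A ⊗ P 3) u v) ((A ⊗ A) u v) (I u v) q ⟩
      ((A ⊗ P 3) u v ℤ.- q ℤ.* P 2 u v) ℤ.- P 2 u v ℤ.+ q ℤ.* ((A ⊗ A) u v ℤ.- (q ℤ.+ 1ℤ) ℤ.* I u v)
        ≡⟨ cong₂ (λ x y → x ℤ.- P 2 u v ℤ.+ q ℤ.* y) (P-recˡ 2 u v) (C₁ u v) ⟨
      P 4 u v ℤ.- P 2 u v ℤ.+ q ℤ.* C 1 u v
        ∎
      where
      lemma : ∀ x y i q → x ℤ.- y ℤ.+ q ℤ.* y ℤ.- q ℤ.* (y ℤ.- (q ℤ.+ 1ℤ) ℤ.* i)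
            ≡ (x ℤ.- q ℤ.* (y ℤ.- q ℤ.* (+ 2 ℤ.* i))) ℤ.- (y ℤ.- q ℤ.* (+ 2 ℤ.* i)) ℤ.+ q ℤ.* (y ℤ.- (q ℤ.+ 1ℤ) ℤ.* i)
      lemma = solve-∀
    rest (suc k) = begin
      (A ⊗ P (4 + k)) u v ℤ.- (A ⊗ P (2 + k)) u v ℤ.+ q ℤ.* (A ⊗ C (1 + k)) u v ℤ.- q ℤ.* C (2 + k) u v
        ≡⟨ cong (λ x → (A ⊗ P (4 + k)) u v ℤ.- (A ⊗ P (2 + k)) u v ℤ.+ q ℤ.* (A ⊗ C (1 + k)) u v ℤ.- q ℤ.* x) (C-via-P C C₀ C₁ C-rec k u v) ⟩
      (A ⊗ P (4 + k)) u v ℤ.- (A ⊗ P (2 + k)) u v ℤ.+ q ℤ.* (A ⊗ C (1 + k)) u v ℤ.- q ℤ.* (P (3 + k) u v ℤ.- P (1 + k) u v ℤ.+ q ℤ.* C k u v)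
        ≡⟨ lemma ((A ⊗ P (4 + k)) u v) ((A ⊗ P (2 + k)) u v) ((A ⊗ C (1 + k)) u v) (P (3 + k) u v) (P (1 + k) u v) (C k u v) q ⟩
      ((A ⊗ P (4 + k)) u v ℤ.- q ℤ.* P (3 + k) u v) ℤ.- ((A ⊗ P (2 + k)) u v ℤ.- q ℤ.* P (1 + k) u v) ℤ.+ q ℤ.* ((A ⊗ C (1 + k)) u v ℤ.- q ℤ.* C k u v)
        ≡⟨ cong₂ ℤ._+_ (cong₂ ℤ._-_ (P-recˡ (3 + k) u v) (P-recˡ (1 + k) u v)) (cong (q ℤ.*_) (C-rec k u v)) ⟨
      P (5 + k) u v ℤ.- P (3 + k) u v ℤ.+ q ℤ.* C (2 + k) u v
        ∎
      where
      lemma : ∀ a b c x y z q → a ℤ.- b ℤ.+ q ℤ.* c ℤ.- q ℤ.* (x ℤ.- y ℤ.+ q ℤ.* z) ≡ (a ℤ.- q ℤ.* x) ℤ.- (b ℤ.- q ℤ.* y) ℤ.+ q ℤ.* (c ℤ.- q ℤ.* z)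
      lemma = solve-∀

-- The procedure Indices

2*suc : ∀ h → 2 * suc h ≡ suc (suc (2 * h))
2*suc h = *-suc 2 h

data Parity : ℕ → Set where
  even : ∀ h → Parity (2 * h)
  odd  : ∀ h → Parity (suc (2 * h))

parity : ∀ k → Parity k
parity zero    = even 0
parity (suc k) with parity k
... | even h = odd h
... | odd h  = subst Parity (2*suc h) (even (suc h))

2∤odd : ∀ h → ¬ 2 ∣ suc (2 * h)
2∤odd h 2∣ with () ← ∣1⇒≡1 (∣m+n∣m⇒∣n (subst (2 ∣_) (+-comm 1 (2 * h)) 2∣) (m∣m*n h))

does-even : ∀ h → does (even? (2 * h)) ≡ true
does-even h = dec-true (even? (2 * h)) (m∣m*n h)

does-odd : ∀ h → does (even? (suc (2 * h))) ≡ false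
does-odd h = dec-false (even? (suc (2 * h))) (2∤odd h)

⌊2*h/2⌋ : ∀ h → ⌊ 2 * h /2⌋ ≡ h
⌊2*h/2⌋ zero    = refl
⌊2*h/2⌋ (suc h) = trans (cong ⌊_/2⌋ (2*suc h)) (cong suc (⌊2*h/2⌋ h))

⌊1+2*h/2⌋ : ∀ h → ⌊ suc (2 * h) /2⌋ ≡ h
⌊1+2*h/2⌋ zero    = refl
⌊1+2*h/2⌋ (suc h) = trans (cong (⌊_/2⌋ ∘ suc) (2*suc h)) (cong suc (⌊1+2*h/2⌋ h))

-- Each constructor is one branch of the procedure: the subscript is the
-- value of j chosen there.  The inequality in even₂ makes the test for
-- j = 1 fail.
data Good : List ℕ → Set where
  one   : Good (1 ∷ [])
  even₁ : ∀ {a L} → Good (a ∷ L) → Good (2 * a ∷ a ∷ L)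
  even₂ : ∀ {a b L} → a ≢ b → Good (b ∷ a ∷ L) → Good (2 * a ∷ b ∷ a ∷ L)
  odd₁  : ∀ {a L} → Good (suc a ∷ a ∷ L) → Good (suc (2 * a) ∷ suc a ∷ a ∷ L)
  odd₂  : ∀ {a b L} → Good (b ∷ suc a ∷ a ∷ L) → Good (suc (2 * a) ∷ b ∷ suc a ∷ a ∷ L)

-- What the second loop appends when it is entered with k = 2 a + 1.
data Tail : ℕ → List ℕ → Set where
  stop : Tail 0 []
  pair : ∀ {a M} → Good (2 + a ∷ suc a ∷ M) → Tail (suc a) (2 + a ∷ suc a ∷ M)

Tail⇒Good : ∀ {a M} → Tail a M → Good (suc (2 * a) ∷ M)
Tail⇒Good stop     = one
Tail⇒Good (pair g) = odd₁ g

-- The loop goes on from the second member of the pair, 2 b + 1. The first member is twice b + 1,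
-- the head of M; only in the last pair 2, 1 does its half follow immediately.
Tail-odd : ∀ {b M} → Tail b M → Tail (suc (2 * b)) (2 + 2 * b ∷ suc (2 * b) ∷ M)
Tail-odd {b} {M} t = pair (subst (λ x → Good (x ∷ suc (2 * b) ∷ M)) (2*suc b) (good t))
  where
  good : Tail b M → Good (2 * suc b ∷ suc (2 * b) ∷ M)
  good stop                = even₁ one
  good t@(pair {a = b′} _) = even₂ (m≢1+m+n (suc b′) ∘ λ eq → trans (suc-injective eq) (cong suc (+-suc b′ (b′ + 0)))) (Tail⇒Good t)

-- The loop goes on from the first member of the pair. M begins with b + 2, b + 1: their sum is the
-- first member, and twice the latter is the second.
Tail-even : ∀ {b M} → Tail (suc b) M → Tail (2 * suc b) (suc (2 * suc b) ∷ 2 * suc b ∷ M)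
Tail-even t@(pair _) = pair (odd₂ (even₂ (1+n≢n ∘ sym) (drop₁ t)))
  where
  drop₁ : ∀ {b M} → Tail (suc b) M → Good M
  drop₁ (pair g) = g

∷ʳ-∷ʳ-++ : ∀ L M {k m : ℕ} → k ≡ suc m → (L ∷ʳ k ∷ʳ (k ∸ 1)) ++ M ≡ L ++ suc m ∷ m ∷ M
∷ʳ-∷ʳ-++ L M refl = trans (++-assoc (L ∷ʳ _) _ M) (++-assoc L _ _)

-- The invariant is that k is odd. The parity of a decides the branch: the halved value a + 1 is
-- kept if a is even and lowered to a if a is odd.
loop₂-Tail : ∀ k (rec : Acc _<_ k) L a → k ≡ suc (2 * a) →
             ∃[ M ] loop₂ k rec L ≡ L ++ M × Tail a M
loop₂-Tail (suc zero)        rec      L zero refl = [] , sym (++-identityʳ L) , stop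
loop₂-Tail k@(suc (suc k-2)) (acc rs) L a    eq   with parity a
... | odd h =
  let (M , loop≡ , tail) = loop₂-Tail (k′ ∸ 1) (rs (≤-trans (n≤1+n _) k′<k)) L′ h (cong (_∸ 1) k′≡)
  in  2 + 2 * h ∷ suc (2 * h) ∷ M
    , trans (if-cong (trans (cong (does ∘ even?) (trans k′≡ (sym (2*suc h)))) (does-even (suc h)))) (trans loop≡ (∷ʳ-∷ʳ-++ L M k′≡))
    , Tail-odd tail
  where
  k′ = ⌈ k /2⌉
  L′ = L ∷ʳ k′ ∷ʳ (k′ ∸ 1)
  k′<k = ⌈n/2⌉<n k-2
  k′≡ : k′ ≡ suc (suc (2 * h))
  k′≡ = trans (cong ⌈_/2⌉ eq) (cong suc (⌊2*h/2⌋ (suc (2 * h))))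
-- The case `even zero` would make k equal to 1, which the first clause has dealt with.
... | even (suc h) =
  let (M , loop≡ , tail) = loop₂-Tail k′ (rs k′<k) L′ (suc h) k′≡
  in  suc (2 * suc h) ∷ 2 * suc h ∷ M
    , trans (if-cong (trans (cong (does ∘ even?) k′≡) (does-odd (suc h)))) (trans loop≡ (∷ʳ-∷ʳ-++ L M k′≡))
    , Tail-even tail
  where
  k′ = ⌈ k /2⌉
  L′ = L ∷ʳ k′ ∷ʳ (k′ ∸ 1)
  k′<k = ⌈n/2⌉<n k-2
  k′≡ : k′ ≡ suc (2 * suc h)
  k′≡ = trans (cong ⌈_/2⌉ eq) (cong suc (⌊2*h/2⌋ (2 * suc h)))

loops : ℕ × List ℕ → List ℕ
loops (k₁ , L) = loop₂ k₁ (<-wellFounded k₁) L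

loops-Good : ∀ k (rec : Acc _<_ k) L → 1 ≤ k → ∃[ M ] loops (loop₁ k rec L) ≡ L ++ M × Good (k ∷ M)
loops-Good k rec L 1≤k with parity k
loops-Good _ (acc rs) L _ | even (suc h) =
  let (M , loops≡ , good) = loops-Good ⌊ k /2⌋ (rs (⌊n/2⌋<n _)) (L ∷ʳ ⌊ k /2⌋) (subst (1 ≤_) (sym ⌊k/2⌋≡) (s≤s z≤n))
  in  ⌊ k /2⌋ ∷ M
    , trans (cong loops (if-cong (does-even (suc h)))) (trans loops≡ (++-assoc L _ M))
    , subst (λ x → Good (k ∷ x ∷ M)) (sym ⌊k/2⌋≡) (even₁ (subst (λ x → Good (x ∷ M)) ⌊k/2⌋≡ good))
  where
  k = 2 * suc h
  ⌊k/2⌋≡ : ⌊ k /2⌋ ≡ suc h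
  ⌊k/2⌋≡ = ⌊2*h/2⌋ (suc h)
loops-Good _ (acc rs) L _ | odd h =
  let (M , loop≡ , tail) = loop₂-Tail (suc (2 * h)) (<-wellFounded _) L h refl
  in  M , trans (cong loops (if-cong (does-odd h))) loop≡ , Tail⇒Good tail

Indices-Good : ∀ k → 1 ≤ k → ∃[ M ] Indices k ≡ k ∷ M × Good (k ∷ M)
Indices-Good k = loops-Good k (<-wellFounded k) (k ∷ [])

-- The loop of the procedure NGC

-- Phrased through `at`, since the procedure reads L by position: the components are the equations
-- that evaluate its tests.
Suffix : ℕ → List ℕ → ℕ → List ℕ → Set
Suffix d L i []       = ⊤
Suffix d L i (x ∷ xs) = at d L i ≡ x × Suffix d L (suc i) xs

Suffix-∷ : ∀ d x {L i} xs → Suffix d L i xs → Suffix d (x ∷ L) (suc i) xs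
Suffix-∷ d x []       _       = tt
Suffix-∷ d x (_ ∷ xs) (e , s) = e , Suffix-∷ d x xs s

Suffix-refl : ∀ d L → Suffix d L 0 L
Suffix-refl d []      = tt
Suffix-refl d (x ∷ L) = refl , Suffix-∷ d x L (Suffix-refl d L)

module _ {n : ℕ} (A : Matrix n) (k : ℕ) (unspecified : Unspecified n) where
  private
    open Unspecified unspecified
    q′ = q A k unspecified
    A^ = P A q′

    L′[_] : ℕ → ℕ
    L′[_] = L[_] A k unspecified

    step′    = step    A k unspecified
    oddStep′ = oddStep A k unspecified
    evenStep′ = evenStep A k unspecified
    run′     = run     A k unspecified

  Entry : ℕ → ℤ → Matrix n → Set
  Entry x c M = c ≡ q′ ℤ.^ ⌊ x /2⌋ × M ≈ A^ x

  -- The comparison ends with the shorter side: slots beyond the list may hold anything, as the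
  -- unspecified initial ones do, and list entries beyond the slots have been shifted out.
  Entries : ∀ {m} → List ℕ → Vector ℤ m → Vector (Matrix n) m → Set
  Entries         []      Q T = ⊤
  Entries {zero}  (x ∷ L) Q T = ⊤
  Entries {suc m} (x ∷ L) Q T = Entry x (Q zero) (T zero) × Entries L (Vector.tail Q) (Vector.tail T)

  Entries-init : ∀ {m} L (Q : Vector ℤ (suc m)) T → Entries L Q T → Entries L (Vector.init Q) (Vector.init T)
  Entries-init         []      Q T _        = tt
  Entries-init {zero}  (x ∷ L) Q T _        = tt
  Entries-init {suc m} (x ∷ L) Q T (e , es) = e , Entries-init L (Vector.tail Q) (Vector.tail T) es

  Represents : List ℕ → State n → Set
  Represents L s = Entries L (State.Q s) (State.T s)

  evenQ : Bool → ℤ → ℤ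
  evenQ b c = if b then c ℤ.* c else q′ ℤ.* (c ℤ.* c)

  -- The body of `evenStep` with the slot and the parity bit as arguments, so that the values known
  -- in a branch can be put in for the tests.
  evenState : Fin 4 → Bool → State n → State n
  evenState j b ⟨ Q , T ⟩ = ⟨ set₀ (evenQ b (Q j)) Q , set₀ (T j ⊗ T j ⊖ (+ 2 ℤ.* evenQ b (Q j)) · I) T ⟩

  oddState : Fin 3 → State n → State n
  oddState j ⟨ Q , T ⟩ = ⟨ set₀ c Q , set₀ (T (inject₁ j) ⊗ T (suc j) ⊖ c · A) T ⟩
    where c = Q (inject₁ j) ℤ.* Q (suc j)

  shifted : State n → State n
  shifted ⟨ Q , T ⟩ = ⟨ shift Q , shift T ⟩

  step-even : ∀ i a s → L′[ i ] ≡ 2 * a → step′ i s ≡ evenStep′ i (shifted s)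
  step-even i a s eq = if-cong (trans (cong (does ∘ even?) eq) (does-even a))

  step-odd : ∀ i a s → L′[ i ] ≡ suc (2 * a) → step′ i s ≡ oddStep′ i (shifted s)
  step-odd i a s eq = if-cong (trans (cong (does ∘ even?) eq) (does-odd a))

  evenStep≡ : ∀ i {j a} s →
              (if does (L′[ i ] ≟ 2 * L′[ suc i ]) then suc zero else suc (suc zero)) ≡ j →
              L′[ i + toℕ j ] ≡ a → evenStep′ i s ≡ evenState j (does (even? a)) s
  evenStep≡ i s refl refl = refl

  oddStep≡ : ∀ i {j} s →
             (if does (L′[ i ] ≟ 2 * L′[ 2 + i ] ∸ 1) then suc (suc zero) else suc zero) ≡ j →
             oddStep′ i s ≡ oddState j s
  oddStep≡ i s refl = refl

  -- Twice ⌊ a /2⌋ falls short of a by 1 exactly when a is odd; the extra factor `q′` makes up for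
  -- it.
  evenQ-correct : ∀ a → evenQ (does (even? a)) (q′ ℤ.^ ⌊ a /2⌋) ≡ q′ ℤ.^ a
  evenQ-correct a with parity a
  ... | even h = begin
    evenQ (does (even? (2 * h))) (q′ ℤ.^ ⌊ 2 * h /2⌋)  ≡⟨ cong₂ (λ b m → evenQ b (q′ ℤ.^ m)) (does-even h) (⌊2*h/2⌋ h) ⟩
    q′ ℤ.^ h ℤ.* q′ ℤ.^ h                              ≡⟨ ℤ.^-distribˡ-+-* q′ h h ⟨
    q′ ℤ.^ (h + h)                                     ≡⟨ cong (λ m → q′ ℤ.^ (h + m)) (+-identityʳ h) ⟨
    q′ ℤ.^ (2 * h)                                     ∎
  ... | odd h = begin
    evenQ (does (even? (suc (2 * h)))) (q′ ℤ.^ ⌊ suc (2 * h) /2⌋)  ≡⟨ cong₂ (λ b m → evenQ b (q′ ℤ.^ m)) (does-odd h) (⌊1+2*h/2⌋ h) ⟩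
    q′ ℤ.* (q′ ℤ.^ h ℤ.* q′ ℤ.^ h)                     ≡⟨ cong (q′ ℤ.*_) (ℤ.^-distribˡ-+-* q′ h h) ⟨
    q′ ℤ.* q′ ℤ.^ (h + h)                              ≡⟨ cong (λ m → q′ ℤ.* q′ ℤ.^ (h + m)) (+-identityʳ h) ⟨
    q′ ℤ.^ (suc (2 * h))                               ∎

  -- This is `P⊗P` with d = 0; the 2 in the procedure comes from P₀ = 2 I.
  Entry-even : ∀ a {c M} → Entry a c M →
               Entry (2 * a) (evenQ (does (even? a)) c) (M ⊗ M ⊖ (+ 2 ℤ.* evenQ (does (even? a)) c) · I)
  Entry-even a {c} {M} (refl , M≈) = trans (evenQ-correct a) (cong (q′ ℤ.^_) (sym (⌊2*h/2⌋ a))) , λ u v → begin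
    (M ⊗ M) u v ℤ.- (+ 2 ℤ.* evenQ (does (even? a)) c) ℤ.* I u v
      ≡⟨ cong₂ (λ x y → x ℤ.- (+ 2 ℤ.* y) ℤ.* I u v) (trans (⊗-cong M≈ M≈ u v) (P⊗P A q′ a 0 (sym (+-identityʳ a)) (cong (λ x → a + x) (+-identityʳ a)) u v)) (evenQ-correct a) ⟩
    A^ (2 * a) u v ℤ.+ (q′ ℤ.^ a) ℤ.* (+ 2 ℤ.* I u v) ℤ.- (+ 2 ℤ.* (q′ ℤ.^ a)) ℤ.* I u v
      ≡⟨ lemma (A^ (2 * a) u v) (q′ ℤ.^ a) (I u v) ⟩
    A^ (2 * a) u v
      ∎
    where
    lemma : ∀ x y i → x ℤ.+ y ℤ.* (+ 2 ℤ.* i) ℤ.- (+ 2 ℤ.* y) ℤ.* i ≡ x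
    lemma = solve-∀

  -- This is `P⊗P` with d = 1, whose correction term is P₁ = A.
  Entry-odd : ∀ a {c c′ M M′} → Entry (suc a) c M → Entry a c′ M′ →
              Entry (suc (2 * a)) (c ℤ.* c′) (M ⊗ M′ ⊖ (c ℤ.* c′) · A)
  Entry-odd a {c} {c′} {M} {M′} (refl , M≈) (refl , M′≈) = trans cc′≡ (cong (q′ ℤ.^_) (sym (⌊1+2*h/2⌋ a))) , λ u v → begin
    (M ⊗ M′) u v ℤ.- (c ℤ.* c′) ℤ.* A u v
      ≡⟨ cong₂ (λ x y → x ℤ.- y ℤ.* A u v) (trans (⊗-cong M≈ M′≈ u v) (P⊗P A q′ a 1 (+-comm 1 a) (sym (trans (+-suc a a) (cong (λ x → suc (a + x)) (sym (+-identityʳ a))))) u v)) cc′≡ ⟩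
    A^ (suc (2 * a)) u v ℤ.+ (q′ ℤ.^ a) ℤ.* A u v ℤ.- (q′ ℤ.^ a) ℤ.* A u v
      ≡⟨ lemma (A^ (suc (2 * a)) u v) ((q′ ℤ.^ a) ℤ.* A u v) ⟩
    A^ (suc (2 * a)) u v
      ∎
    where
    lemma : ∀ x y → x ℤ.+ y ℤ.- y ≡ x
    lemma = solve-∀
    cc′≡ : c ℤ.* c′ ≡ q′ ℤ.^ a
    -- By definition ⌊ suc a /2⌋ is ⌈ a /2⌉, so the two exponents add up to a.
    cc′≡ = trans (sym (ℤ.^-distribˡ-+-* q′ ⌈ a /2⌉ ⌊ a /2⌋)) (cong (q′ ℤ.^_) (trans (+-comm ⌈ a /2⌉ _) (⌊n/2⌋+⌈n/2⌉≡n a)))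

  -- After the shift, slot j holds the data of the entry j places after `x`. Each constructor of
  -- `Good` settles the comparison that selects j and shows the selected entries.
  step-correct : ∀ {x y L} → Good (x ∷ y ∷ L) → ∀ i s → Suffix oob (Indices k) i (x ∷ y ∷ L) →
                 Represents (y ∷ L) s → Represents (x ∷ y ∷ L) (step′ i s)
  step-correct (even₁ {a} {L} _) i s@(⟨ Q , T ⟩) (Lᵢ , Lᵢ₊₁ , _) es@(e , _) =
    subst (Represents (2 * a ∷ a ∷ L)) (sym (trans (step-even i a s Lᵢ) (evenStep≡ i (shifted s)
      (if-cong (trans (cong₂ (λ x y → does (x ≟ 2 * y)) Lᵢ Lᵢ₊₁) (dec-true (2 * a ≟ 2 * a) refl)))
      (trans (cong L′[_] (+-comm i 1)) Lᵢ₊₁))))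
      (Entry-even a e , Entries-init (a ∷ L) Q T es)
  step-correct (even₂ {a} {b} {L} a≢b _) i s@(⟨ Q , T ⟩) (Lᵢ , Lᵢ₊₁ , Lᵢ₊₂ , _) es@(_ , e , _) =
    subst (Represents (2 * a ∷ b ∷ a ∷ L)) (sym (trans (step-even i a s Lᵢ) (evenStep≡ i (shifted s)
      (if-cong (trans (cong₂ (λ x y → does (x ≟ 2 * y)) Lᵢ Lᵢ₊₁) (dec-false (2 * a ≟ 2 * b) (a≢b ∘ *-cancelˡ-≡ a b 2))))
      (trans (cong L′[_] (+-comm i 2)) Lᵢ₊₂))))
      (Entry-even a e , Entries-init (b ∷ a ∷ L) Q T es)
  step-correct (odd₁ {a} {L} _) i s@(⟨ Q , T ⟩) (Lᵢ , _ , Lᵢ₊₂ , _) es@(e , e′ , _) =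
    subst (Represents (suc (2 * a) ∷ suc a ∷ a ∷ L)) (sym (trans (step-odd i a s Lᵢ) (oddStep≡ i (shifted s)
      (if-cong (trans (cong₂ (λ x y → does (x ≟ 2 * y ∸ 1)) Lᵢ Lᵢ₊₂) (dec-false (suc (2 * a) ≟ 2 * a ∸ 1) (<⇒≢ (s≤s (m∸n≤m (2 * a) 1)) ∘ sym)))))))
      (Entry-odd a e e′ , Entries-init (suc a ∷ a ∷ L) Q T es)
  step-correct (odd₂ {a} {b} {L} _) i s@(⟨ Q , T ⟩) (Lᵢ , _ , Lᵢ₊₂ , _) es@(_ , e , e′ , _) =
    subst (Represents (suc (2 * a) ∷ b ∷ suc a ∷ a ∷ L)) (sym (trans (step-odd i a s Lᵢ) (oddStep≡ i (shifted s)
      (if-cong (trans (cong₂ (λ x y → does (x ≟ 2 * y ∸ 1)) Lᵢ Lᵢ₊₂) (dec-true (suc (2 * a) ≟ 2 * suc a ∸ 1) (sym (+-suc a (a + 0)))))))))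
      (Entry-odd a e e′ , Entries-init (b ∷ suc a ∷ a ∷ L) Q T es)

  init′ : State n
  init′ = ⟨ 1ℤ Vector.∷ Q₀ , A Vector.∷ T₀ ⟩

  -- `run′` counts down, so the entries of the suffix L at position i are computed first; `s` is the
  -- state in which i iterations are still to come.
  Run : ℕ → List ℕ → Set
  Run i L = ∃[ s ] Represents L s × run′ (i + (length L ∸ 1)) init′ ≡ run′ i s

  extend : ∀ {x y L} → Good (x ∷ y ∷ L) → ∀ i → Suffix oob (Indices k) i (x ∷ y ∷ L) →
           Run (suc i) (y ∷ L) → Run i (x ∷ y ∷ L)
  extend {L = L} good i suffix (s , repr , run≡) =
    step′ i s , step-correct good i s suffix repr , trans (cong (λ m → run′ m init′) (+-suc i (length L))) run≡

  run-correct : ∀ {L} → Good L → ∀ i → Suffix oob (Indices k) i L → Run i L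
  run-correct one i _ = init′ , ((refl , λ _ _ → refl) , tt) , cong (λ m → run′ m init′) (+-identityʳ i)
  run-correct good@(even₁ g)   i suffix = extend good i suffix (run-correct g (suc i) (proj₂ suffix))
  run-correct good@(even₂ _ g) i suffix = extend good i suffix (run-correct g (suc i) (proj₂ suffix))
  run-correct good@(odd₁ g)    i suffix = extend good i suffix (run-correct g (suc i) (proj₂ suffix))
  run-correct good@(odd₂ g)    i suffix = extend good i suffix (run-correct g (suc i) (proj₂ suffix))

  NGC≡ : 1 ≤ k → NGC A k unspecified ≡ (if does (even? k)
                                         then + n ℤ.* (q′ ℤ.- 1ℤ) ℤ.+ trace (A^ k)
                                         else trace (A^ k))
  NGC≡ 1≤k =
    let (M , Indices≡ , good)       = Indices-Good k 1≤k
        (s , ((_ , T≈) , _) , run≡) = run-correct good 0 (subst (Suffix oob (Indices k) 0) Indices≡ (Suffix-refl oob (Indices k)))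
        trace≡                      = trans (cong (λ s → trace (State.T s zero)) (trans (cong (λ L → run′ (length L ∸ 1) init′) Indices≡) run≡)) (trace-cong T≈)
    in  trans (cong (λ L → result (at oob L 0) (trace (State.T (run′ (length (Indices k) ∸ 1) init′) zero))) Indices≡) (cong (result k) trace≡)
    where
    result : ℕ → ℤ → ℤ
    result k t = if does (even? k) then + n ℤ.* (q′ ℤ.- 1ℤ) ℤ.+ t else t

-- Sums over lists

-- Summation over positions inherits linearity and interchange from `sum`, and still unfolds
-- definitionally along the list.
∑ : {A : Set} → List A → (A → ℤ) → ℤ
∑ xs f = sum (λ i → f (lookup xs i))

∑-cong : {A : Set} (xs : List A) {f g : A → ℤ} → (∀ x → f x ≡ g x) → ∑ xs f ≡ ∑ xs g
∑-cong xs f≡g = sum-cong-≗ λ i → f≡g (lookup xs i)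

∑-swap : {A B : Set} (xs : List A) (ys : List B) (f : A → B → ℤ) →
         ∑ xs (λ x → ∑ ys (f x)) ≡ ∑ ys (λ y → ∑ xs (λ x → f x y))
∑-swap xs ys f = ∑-comm (λ i j → f (lookup xs i) (lookup ys j))

∑-sum-swap : {A : Set} (xs : List A) (n : ℕ) (f : A → Fin n → ℤ) →
             ∑ xs (λ x → sum (f x)) ≡ sum (λ u → ∑ xs (λ x → f x u))
∑-sum-swap xs n f = ∑-comm (λ i → f (lookup xs i))

*-distribˡ-∑ : {A : Set} (c : ℤ) (xs : List A) (f : A → ℤ) → c ℤ.* ∑ xs f ≡ ∑ xs (λ x → c ℤ.* f x)
*-distribˡ-∑ c xs f = *-distribˡ-sum c (λ i → f (lookup xs i))

*-distribʳ-∑ : {A : Set} (c : ℤ) (xs : List A) (f : A → ℤ) → ∑ xs f ℤ.* c ≡ ∑ xs (λ x → f x ℤ.* c)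
*-distribʳ-∑ c xs f = *-distribʳ-sum c (λ i → f (lookup xs i))

∑-⊖ : {A : Set} (xs : List A) (f g : A → ℤ) → ∑ xs (λ x → f x ℤ.- g x) ≡ ∑ xs f ℤ.- ∑ xs g
∑-⊖ xs f g = sum-⊖ (λ i → f (lookup xs i)) (λ i → g (lookup xs i))

∑-++ : {A : Set} (xs ys : List A) (f : A → ℤ) → ∑ (xs ++ ys) f ≡ ∑ xs f ℤ.+ ∑ ys f
∑-++ []       ys f = sym (ℤ.+-identityˡ _)
∑-++ (x ∷ xs) ys f = trans (cong (ℤ._+_ (f x)) (∑-++ xs ys f)) (sym (ℤ.+-assoc (f x) (∑ xs f) (∑ ys f)))

∑-map : {A B : Set} (h : A → B) (xs : List A) (f : B → ℤ) → ∑ (map h xs) f ≡ ∑ xs (f ∘ h)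
∑-map h []       f = refl
∑-map h (x ∷ xs) f = cong (ℤ._+_ (f (h x))) (∑-map h xs f)

∑-cartesianProductWith : {A B C : Set} (h : A → B → C) (xs : List A) (ys : List B) (f : C → ℤ) →
                         ∑ (cartesianProductWith h xs ys) f ≡ ∑ xs (λ x → ∑ ys (λ y → f (h x y)))
∑-cartesianProductWith h []       ys f = refl
∑-cartesianProductWith h (x ∷ xs) ys f =
  trans (∑-++ (map (h x) ys) (cartesianProductWith h xs ys) f)
        (cong₂ ℤ._+_ (∑-map (h x) ys f) (∑-cartesianProductWith h xs ys f))

∑-tabulate : {A : Set} {n : ℕ} (h : Fin n → A) (f : A → ℤ) → ∑ (tabulate h) f ≡ sum (f ∘ h)
∑-tabulate {n = zero}  h f = refl
∑-tabulate {n = suc n} h f = cong (ℤ._+_ (f (h zero))) (∑-tabulate (h ∘ suc) f)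

length-filter : {A : Set} {Q : A → Set} (Q? : ∀ x → Dec (Q x)) (xs : List A) →
                + length (filter Q? xs) ≡ ∑ xs (λ x → ⟦ Q? x ⟧)
length-filter Q? []       = refl
length-filter Q? (x ∷ xs) with Q? x
... | yes _ = cong (ℤ._+_ 1ℤ) (length-filter Q? xs)
... | no _  = trans (length-filter Q? xs) (sym (ℤ.+-identityˡ _))

-- Cyclic positions

toℕ-mod : ∀ a n → toℕ (a mod suc n) ≡ a % suc n
toℕ-mod a n = toℕ-fromℕ< (m%n<n a (suc n))

suc-% : ∀ a n → suc a % suc n ≡ suc (a % suc n) % suc n
suc-% a n = trans (cong (λ x → suc x % suc n) (m≡m%n+[m/n]*n a (suc n))) ([m+kn]%n≡m%n (suc (a % suc n)) (a / suc n) (suc n))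

-- Two cyclically consecutive positions are either neighbours in the vector or its last and first
-- positions. This reduces all cyclic shifts to the inner steps and one closing step.
mod-suc : ∀ n a → (∃[ i ] a mod suc n ≡ inject₁ i × suc a mod suc n ≡ suc i)
                ⊎ (a mod suc n ≡ fromℕ n × suc a mod suc n ≡ zero)
mod-suc n a with a % suc n <? n
... | yes a%<n = inj₁ (fromℕ< a%<n
  , toℕ-injective (trans (toℕ-mod a n) (sym (trans (toℕ-inject₁ _) (toℕ-fromℕ< a%<n))))
  , toℕ-injective (trans (toℕ-mod (suc a) n) (trans (suc-% a n) (trans (m<n⇒m%n≡m (s≤s a%<n)) (cong suc (sym (toℕ-fromℕ< a%<n)))))))
... | no a%≮n = inj₂
  ( toℕ-injective (trans (toℕ-mod a n) (trans a%≡n (sym (toℕ-fromℕ n))))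
  , toℕ-injective (trans (toℕ-mod (suc a) n) (trans (suc-% a n) (trans (cong (λ x → suc x % suc n) a%≡n) (n%n≡0 (suc n))))))
  where
  a%≡n : a % suc n ≡ n
  a%≡n = ≤-antisym (s≤s⁻¹ (m%n<n a (suc n))) (≮⇒≥ a%≮n)

mod-toℕ : ∀ {n} (i : Fin (suc n)) → toℕ i mod suc n ≡ i
mod-toℕ {n} i = toℕ-injective (trans (toℕ-mod (toℕ i) n) (m<n⇒m%n≡m (toℕ<n i)))

-- Geodesic cycles as closed non-backtracking paths

module _ {n : ℕ} (X : Graph n) where
  open Graph X

  private
    E = orientedEdges X
    s = start X
    t = end X
    op = opposite X
    _≟ᴱ_ = _≟ᵒ_ X
    A = adjacency X

  op-op : ∀ e → op (op e) ≡ e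
  op-op (e , b) = cong (e ,_) (Bool.not-involutive b)

  start-op : ∀ e → s (op e) ≡ t e
  start-op (e , true)  = refl
  start-op (e , false) = refl

  end-op : ∀ e → t (op e) ≡ s e
  end-op (e , true)  = refl
  end-op (e , false) = refl

  op≢ : ∀ e → op e ≢ e
  op≢ (e , true)  ()
  op≢ (e , false) ()

  ∑ᴱ : (OEdge X → ℤ) → ℤ
  ∑ᴱ = ∑ E

  -- Rests on `orientedEdges` listing each oriented edge exactly once.
  ∑ᴱ-δ : ∀ a (f : OEdge X → ℤ) → ∑ᴱ (λ e → ⟦ e ≟ᴱ a ⟧ ℤ.* f e) ≡ f a
  ∑ᴱ-δ (a , b) f = begin
    ∑ᴱ (λ e → ⟦ e ≟ᴱ (a , b) ⟧ ℤ.* f e)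
      ≡⟨ ∑-cartesianProductWith _,_ (allFin #edges) (true ∷ false ∷ []) (λ e → ⟦ e ≟ᴱ (a , b) ⟧ ℤ.* f e) ⟩
    ∑ (allFin #edges) (λ i → ⟦ (i , true) ≟ᴱ (a , b) ⟧ ℤ.* f (i , true) ℤ.+ (⟦ (i , false) ≟ᴱ (a , b) ⟧ ℤ.* f (i , false) ℤ.+ 0ℤ))
      ≡⟨ ∑-tabulate (λ i → i) (λ i → ⟦ (i , true) ≟ᴱ (a , b) ⟧ ℤ.* f (i , true) ℤ.+ (⟦ (i , false) ≟ᴱ (a , b) ⟧ ℤ.* f (i , false) ℤ.+ 0ℤ)) ⟩
    sum (λ i → ⟦ (i , true) ≟ᴱ (a , b) ⟧ ℤ.* f (i , true) ℤ.+ (⟦ (i , false) ≟ᴱ (a , b) ⟧ ℤ.* f (i , false) ℤ.+ 0ℤ))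
      ≡⟨ sum-cong-≗ (pick b) ⟩
    sum (λ i → ⟦ i ≟ᶠ a ⟧ ℤ.* f (i , b))
      ≡⟨ sum-δ′ a (λ i → f (i , b)) ⟩
    f (a , b)
      ∎
    where
    same : ∀ i b → ⟦ (i , b) ≟ᴱ (a , b) ⟧ ≡ ⟦ i ≟ᶠ a ⟧
    same i b = ⟦⟧-⇔ ((i , b) ≟ᴱ (a , b)) (i ≟ᶠ a) (cong proj₁) (cong (_, b))
    differ : ∀ i {b b′} → b ≢ b′ → ⟦ (i , b) ≟ᴱ (a , b′) ⟧ ≡ 0ℤ
    differ i {b} {b′} b≢ = ⟦⟧-false ((i , b) ≟ᴱ (a , b′)) (b≢ ∘ cong proj₂)
    left : ∀ x y → x ℤ.+ (0ℤ ℤ.* y ℤ.+ 0ℤ) ≡ x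
    left = solve-∀
    right : ∀ x y → 0ℤ ℤ.* y ℤ.+ (x ℤ.+ 0ℤ) ≡ x
    right = solve-∀
    pick : ∀ b i → ⟦ (i , true) ≟ᴱ (a , b) ⟧ ℤ.* f (i , true) ℤ.+ (⟦ (i , false) ≟ᴱ (a , b) ⟧ ℤ.* f (i , false) ℤ.+ 0ℤ) ≡ ⟦ i ≟ᶠ a ⟧ ℤ.* f (i , b)
    pick true i = trans (cong₂ (λ x y → x ℤ.* f (i , true) ℤ.+ (y ℤ.* f (i , false) ℤ.+ 0ℤ)) (same i true) (differ i {false} {true} λ ()))
                        (left (⟦ i ≟ᶠ a ⟧ ℤ.* f (i , true)) (f (i , false)))
    pick false i = trans (cong₂ (λ x y → x ℤ.* f (i , true) ℤ.+ (y ℤ.* f (i , false) ℤ.+ 0ℤ)) (differ i {true} {false} λ ()) (same i false))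
                        (right (⟦ i ≟ᶠ a ⟧ ℤ.* f (i , false)) (f (i , true)))

  Step : OEdge X → OEdge X → Set
  Step e f = t e ≡ s f × f ≢ op e

  step? : ∀ e f → Dec (Step e f)
  step? e f = (t e ≟ᶠ s f) ×-dec ¬? (f ≟ᴱ op e)

  -- The edge `op e` starts where e ends, so the subtracted indicator is supported inside the first
  -- one.
  ⟦step?⟧ : ∀ e f → ⟦ step? e f ⟧ ≡ ⟦ s f ≟ᶠ t e ⟧ ℤ.- ⟦ f ≟ᴱ op e ⟧
  ⟦step?⟧ e f = by-cases f (f ≟ᴱ op e)
    where
    by-cases : ∀ f (d : Dec (f ≡ op e)) → ⟦ (t e ≟ᶠ s f) ×-dec ¬? d ⟧ ≡ ⟦ s f ≟ᶠ t e ⟧ ℤ.- ⟦ d ⟧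
    by-cases f d@(yes refl) = trans (⟦⟧-false ((t e ≟ᶠ s f) ×-dec ¬? d) (λ (_ , f≢) → f≢ refl))
                                    (sym (cong (ℤ._- 1ℤ) (⟦⟧-true (s f ≟ᶠ t e) (start-op e))))
    by-cases f d@(no f≢)    = trans (⟦⟧-⇔ ((t e ≟ᶠ s f) ×-dec ¬? d) (s f ≟ᶠ t e) (sym ∘ proj₁) (λ eq → sym eq , f≢))
                                    (sym (ℤ.+-identityʳ ⟦ s f ≟ᶠ t e ⟧))

  Path : ∀ m → OEdge X → Vector (OEdge X) m → OEdge X → Set
  Path zero    e w f = Step e f
  Path (suc m) e w f = Step e (w zero) × Path m (w zero) (Vector.tail w) f

  path? : ∀ m e w f → Dec (Path m e w f)
  path? zero    e w f = step? e f
  path? (suc m) e w f = step? e (w zero) ×-dec path? m (w zero) (Vector.tail w) f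

  -- The condition of `Path` by positions, as in `IsGeodesicCycle`; the recursion of `Path` instead
  -- follows `sequences` and the powers of B.
  Steps : ∀ {m} → Vector (OEdge X) (suc m) → OEdge X → Set
  Steps {m} w f = (∀ (i : Fin m) → Step (w (inject₁ i)) (w (suc i))) × Step (w (fromℕ m)) f

  Path⇒Steps : ∀ {m} w f → Path m (Vector.head w) (Vector.tail w) f → Steps w f
  Path⇒Steps {zero}  w f p       = (λ ()) , p
  Path⇒Steps {suc m} w f (p , ps) with Path⇒Steps (Vector.tail w) f ps
  ... | steps , last = (λ { zero → p ; (suc i) → steps i }) , last

  Steps⇒Path : ∀ {m} w f → Steps w f → Path m (Vector.head w) (Vector.tail w) f
  Steps⇒Path {zero}  w f (_ , last)     = last
  Steps⇒Path {suc m} w f (steps , last) = steps zero , Steps⇒Path (Vector.tail w) f (steps ∘ suc , last)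

  Steps⇒Geodesic : ∀ {m} w → Steps {m} w (w zero) → IsGeodesicCycle X w
  Steps⇒Geodesic {m} w (steps , last) = (proj₁ ∘ steps , sym (proj₁ last)) , λ j (i , back) →
    proj₂ (next (toℕ j + toℕ (inject₁ i)))
          (subst (λ a → w (a mod suc m) ≡ op (w ((toℕ j + toℕ (inject₁ i)) mod suc m)))
                 (trans (+-suc (toℕ j) (toℕ i)) (cong (λ x → suc (toℕ j + x)) (sym (toℕ-inject₁ i))))
                 back)
    where
    next : ∀ a → Step (w (a mod suc m)) (w (suc a mod suc m))
    next a with mod-suc m a
    ... | inj₁ (i , eq , eq′) = subst₂ (λ x y → Step (w x) (w y)) (sym eq) (sym eq′) (steps i)
    ... | inj₂ (eq , eq′)     = subst₂ (λ x y → Step (w x) (w y)) (sym eq) (sym eq′) last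

  -- The trivial shift excludes backtracking at the inner steps, and the shift that begins at the
  -- last edge excludes it at the closing step.
  Geodesic⇒Steps : ∀ {m} w → IsGeodesicCycle X w → Steps {m} w (w zero)
  Geodesic⇒Steps {m} w ((walk , cycle) , backtrackless) =
    (λ i → walk i , λ back → backtrackless zero (i , trans (cong w (mod-toℕ (suc i))) (trans back (cong (op ∘ w) (sym (mod-toℕ (inject₁ i)))))))
    , sym cycle , closing w backtrackless
    where
    closing : ∀ {m} (w : Vector (OEdge X) (suc m)) → (∀ j → Backtrackless X (cyclicShift X j w)) → w zero ≢ op (w (fromℕ m))
    -- A sequence of length 1 has no pair of neighbours in any shift; here the closing step is sound
    -- because an edge, even a loop, differs from its opposite.
    closing {zero}  w _ back = op≢ (w zero) (sym back)
    closing {suc m} w backtrackless back = backtrackless (fromℕ (suc m)) (zero , trans (cong w wraps) (trans back (cong (op ∘ w) (sym stays))))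
      where
      stays : (toℕ (fromℕ (suc m)) + 0) mod suc (suc m) ≡ fromℕ (suc m)
      stays = trans (cong (_mod suc (suc m)) (+-identityʳ (toℕ (fromℕ (suc m))))) (mod-toℕ (fromℕ (suc m)))
      wraps : (toℕ (fromℕ (suc m)) + 1) mod suc (suc m) ≡ zero
      wraps = toℕ-injective (trans (toℕ-mod (toℕ (fromℕ (suc m)) + 1) (suc m)) (trans (cong (_% suc (suc m)) (trans (+-comm (toℕ (fromℕ (suc m))) 1) (cong suc (toℕ-fromℕ (suc m))))) (n%n≡0 (suc (suc m)))))

  ⟦isGeodesicCycle?⟧ : ∀ {m} e (w : Vector (OEdge X) m) → ⟦ isGeodesicCycle? X (e Vector.∷ w) ⟧ ≡ ⟦ path? m e w e ⟧
  ⟦isGeodesicCycle?⟧ {m} e w = ⟦⟧-⇔ (isGeodesicCycle? X (e Vector.∷ w)) (path? m e w e)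
    (Steps⇒Path (e Vector.∷ w) e ∘ Geodesic⇒Steps (e Vector.∷ w))
    (Steps⇒Geodesic (e Vector.∷ w) ∘ Path⇒Steps (e Vector.∷ w) e)

  infixr 8 B^_·_

  -- Bᵏ M for the non-backtracking (Hashimoto) matrix B.
  B^_·_ : {Y : Set} → ℕ → (OEdge X → Y → ℤ) → OEdge X → Y → ℤ
  (B^ zero  · M) e y = M e y
  (B^ suc k · M) e y = ∑ᴱ λ f → ⟦ step? e f ⟧ ℤ.* (B^ k · M) f y

  δ : OEdge X → OEdge X → ℤ
  δ e f = ⟦ e ≟ᴱ f ⟧

  -- The vector holds only the m edges strictly between e and f, hence the power m + 1. Summing over
  -- the first of them splits off one factor B.
  ∑-path : ∀ m e f → ∑ (sequences X m) (λ w → ⟦ path? m e w f ⟧) ≡ (B^ suc m · δ) e f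
  ∑-path zero e f = begin
    ⟦ step? e f ⟧ ℤ.+ 0ℤ                          ≡⟨ ℤ.+-identityʳ _ ⟩
    ⟦ step? e f ⟧                                 ≡⟨ ∑ᴱ-δ f (λ g → ⟦ step? e g ⟧) ⟨
    ∑ᴱ (λ g → ⟦ g ≟ᴱ f ⟧ ℤ.* ⟦ step? e g ⟧)       ≡⟨ ∑-cong E (λ g → ℤ.*-comm ⟦ g ≟ᴱ f ⟧ ⟦ step? e g ⟧) ⟩
    ∑ᴱ (λ g → ⟦ step? e g ⟧ ℤ.* ⟦ g ≟ᴱ f ⟧)       ∎
  ∑-path (suc m) e f = begin
    ∑ (sequences X (suc m)) (λ w → ⟦ path? (suc m) e w f ⟧)
      ≡⟨ ∑-cartesianProductWith Vector._∷_ E (sequences X m) (λ w → ⟦ path? (suc m) e w f ⟧) ⟩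
    ∑ᴱ (λ g → ∑ (sequences X m) (λ w → ⟦ step? e g ×-dec path? m g w f ⟧))
      ≡⟨ ∑-cong E (λ g → trans (∑-cong (sequences X m) (λ w → ⟦⟧-× (step? e g) (path? m g w f))) (sym (*-distribˡ-∑ ⟦ step? e g ⟧ (sequences X m) (λ w → ⟦ path? m g w f ⟧)))) ⟩
    ∑ᴱ (λ g → ⟦ step? e g ⟧ ℤ.* ∑ (sequences X m) (λ w → ⟦ path? m g w f ⟧))
      ≡⟨ ∑-cong E (λ g → cong (ℤ._*_ ⟦ step? e g ⟧) (∑-path m g f)) ⟩
    ∑ᴱ (λ g → ⟦ step? e g ⟧ ℤ.* (B^ suc m · δ) g f)
      ∎

  #geodesicCycles≡ : ∀ k → .{{_ : NonZero k}} → + #geodesicCycles X k ≡ ∑ᴱ (λ e → (B^ k · δ) e e)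
  #geodesicCycles≡ (suc m) = begin
    + length (filter (isGeodesicCycle? X) (sequences X (suc m)))
      ≡⟨ length-filter (isGeodesicCycle? X) (sequences X (suc m)) ⟩
    ∑ (sequences X (suc m)) (λ w → ⟦ isGeodesicCycle? X w ⟧)
      ≡⟨ ∑-cartesianProductWith Vector._∷_ E (sequences X m) (λ w → ⟦ isGeodesicCycle? X w ⟧) ⟩
    ∑ᴱ (λ e → ∑ (sequences X m) (λ w → ⟦ isGeodesicCycle? X (e Vector.∷ w) ⟧))
      ≡⟨ ∑-cong E (λ e → trans (∑-cong (sequences X m) (⟦isGeodesicCycle?⟧ e)) (∑-path m e e)) ⟩
    ∑ᴱ (λ e → (B^ suc m · δ) e e)
      ∎

  -- Incidence matrices and the splitting of B

  module _ {Y : Set} where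

    infixr 8 S·_
    S·_ : (OEdge X → Y → ℤ) → Fin n → Y → ℤ
    (S· M) u y = ∑ᴱ λ f → ⟦ s f ≟ᶠ u ⟧ ℤ.* M f y

    -- B = E S − J, where J exchanges opposite edges and (E S) e f tells
    -- whether e ends where f starts.
    B^suc : ∀ k (M : OEdge X → Y → ℤ) e y → (B^ suc k · M) e y ≡ (S· B^ k · M) (t e) y ℤ.- (B^ k · M) (op e) y
    B^suc k M e y = begin
      ∑ᴱ (λ f → ⟦ step? e f ⟧ ℤ.* N f y)
        ≡⟨ ∑-cong E (λ f → trans (cong (ℤ._* N f y) (⟦step?⟧ e f)) (lemma ⟦ s f ≟ᶠ t e ⟧ ⟦ f ≟ᴱ op e ⟧ (N f y))) ⟩
      ∑ᴱ (λ f → ⟦ s f ≟ᶠ t e ⟧ ℤ.* N f y ℤ.- ⟦ f ≟ᴱ op e ⟧ ℤ.* N f y)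
        ≡⟨ ∑-⊖ E (λ f → ⟦ s f ≟ᶠ t e ⟧ ℤ.* N f y) (λ f → ⟦ f ≟ᴱ op e ⟧ ℤ.* N f y) ⟩
      (S· N) (t e) y ℤ.- ∑ᴱ (λ f → ⟦ f ≟ᴱ op e ⟧ ℤ.* N f y)
        ≡⟨ cong ((ℤ._-_ ((S· N) (t e) y))) (∑ᴱ-δ (op e) (λ f → N f y)) ⟩
      (S· N) (t e) y ℤ.- N (op e) y
        ∎
      where
      N = B^ k · M
      lemma : ∀ a b c → (a ℤ.- b) ℤ.* c ≡ a ℤ.* c ℤ.- b ℤ.* c
      lemma = solve-∀

    -- Separates the power of B from the matrix it acts on, so that a trace can be permuted
    -- cyclically.
    B^-via-δ : ∀ k (M : OEdge X → Y → ℤ) e y → (B^ k · M) e y ≡ ∑ᴱ (λ g → (B^ k · δ) e g ℤ.* M g y)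
    B^-via-δ zero M e y = begin
      M e y                                   ≡⟨ ∑ᴱ-δ e (λ g → M g y) ⟨
      ∑ᴱ (λ g → ⟦ g ≟ᴱ e ⟧ ℤ.* M g y)       ≡⟨ ∑-cong E (λ g → cong (ℤ._* M g y) (⟦⟧-⇔ (g ≟ᴱ e) (e ≟ᴱ g) sym sym)) ⟩
      ∑ᴱ (λ g → ⟦ e ≟ᴱ g ⟧ ℤ.* M g y)       ∎
    B^-via-δ (suc k) M e y = begin
      ∑ᴱ (λ f → ⟦ step? e f ⟧ ℤ.* (B^ k · M) f y)
        ≡⟨ ∑-cong E (λ f → trans (cong (ℤ._*_ ⟦ step? e f ⟧) (B^-via-δ k M f y)) (*-distribˡ-∑ ⟦ step? e f ⟧ E (λ g → Bᵏ f g ℤ.* M g y))) ⟩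
      ∑ᴱ (λ f → ∑ᴱ (λ g → ⟦ step? e f ⟧ ℤ.* (Bᵏ f g ℤ.* M g y)))
        ≡⟨ ∑-swap E E (λ f g → ⟦ step? e f ⟧ ℤ.* (Bᵏ f g ℤ.* M g y)) ⟩
      ∑ᴱ (λ g → ∑ᴱ (λ f → ⟦ step? e f ⟧ ℤ.* (Bᵏ f g ℤ.* M g y)))
        ≡⟨ ∑-cong E (λ g → trans (∑-cong E (λ f → sym (ℤ.*-assoc ⟦ step? e f ⟧ (Bᵏ f g) (M g y)))) (sym (*-distribʳ-∑ (M g y) E (λ f → ⟦ step? e f ⟧ ℤ.* Bᵏ f g)))) ⟩
      ∑ᴱ (λ g → (B^ suc k · δ) e g ℤ.* M g y)
        ∎
      where
      Bᵏ = B^ k · δ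

  incidence : (OEdge X → Fin n) → OEdge X → Fin n → ℤ
  incidence h e v = ⟦ h e ≟ᶠ v ⟧

  trace-S· : (M : OEdge X → Fin n → ℤ) → trace (S· M) ≡ ∑ᴱ (λ f → M f (s f))
  trace-S· M = begin
    sum (λ u → ∑ᴱ (λ f → ⟦ s f ≟ᶠ u ⟧ ℤ.* M f u))  ≡⟨ ∑-sum-swap E n (λ f u → ⟦ s f ≟ᶠ u ⟧ ℤ.* M f u) ⟨
    ∑ᴱ (λ f → sum (λ u → ⟦ s f ≟ᶠ u ⟧ ℤ.* M f u))  ≡⟨ ∑-cong E (λ f → sum-δ (s f) (M f)) ⟩
    ∑ᴱ (λ f → M f (s f))                           ∎

  -- The trace is invariant under cyclic permutation.
  ∑-S·δ : ∀ k h → ∑ᴱ (λ e → (S· B^ k · δ) (h e) e) ≡ trace (S· B^ k · incidence h)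
  ∑-S·δ k h = begin
    ∑ᴱ (λ e → ∑ᴱ (λ f → ⟦ s f ≟ᶠ h e ⟧ ℤ.* Bᵏ f e))
      ≡⟨ ∑-swap E E (λ e f → ⟦ s f ≟ᶠ h e ⟧ ℤ.* Bᵏ f e) ⟩
    ∑ᴱ (λ f → ∑ᴱ (λ e → ⟦ s f ≟ᶠ h e ⟧ ℤ.* Bᵏ f e))
      ≡⟨ ∑-cong E (λ f → ∑-cong E (λ e → trans (ℤ.*-comm ⟦ s f ≟ᶠ h e ⟧ (Bᵏ f e)) (cong (ℤ._*_ (Bᵏ f e)) (⟦⟧-⇔ (s f ≟ᶠ h e) (h e ≟ᶠ s f) sym sym)))) ⟩
    ∑ᴱ (λ f → ∑ᴱ (λ e → Bᵏ f e ℤ.* ⟦ h e ≟ᶠ s f ⟧))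
      ≡⟨ ∑-cong E (λ f → B^-via-δ k (incidence h) f (s f)) ⟨
    ∑ᴱ (λ f → (B^ k · incidence h) f (s f))
      ≡⟨ trace-S· (B^ k · incidence h) ⟨
    trace (S· B^ k · incidence h)
      ∎
    where
    Bᵏ = B^ k · δ

  Z : ℕ → OEdge X → Fin n → ℤ
  Z k = B^ k · incidence t

  -- C k = S Bᵏ E counts the non-backtracking walks of length k + 1, and
  -- R k = S J Bᵏ E.
  C R : ℕ → Matrix n
  C k = S· Z k
  R k = S· (Z k ∘ op)

  C₀ : C 0 ≈ A
  C₀ u v = begin
    ∑ᴱ (λ f → ⟦ s f ≟ᶠ u ⟧ ℤ.* ⟦ t f ≟ᶠ v ⟧)        ≡⟨ ∑-cong E (λ f → ⟦⟧-× (s f ≟ᶠ u) (t f ≟ᶠ v)) ⟨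
    ∑ᴱ (λ f → ⟦ (s f ≟ᶠ u) ×-dec (t f ≟ᶠ v) ⟧)      ≡⟨ length-filter (λ f → (s f ≟ᶠ u) ×-dec (t f ≟ᶠ v)) E ⟨
    A u v                                             ∎

  -- `M ∘ t` is E M, so this is S E = A applied to M.
  S·-end : (M : Matrix n) → S· (M ∘ t) ≈ A ⊗ M
  S·-end M u v = begin
    ∑ᴱ (λ f → ⟦ s f ≟ᶠ u ⟧ ℤ.* M (t f) v)
      ≡⟨ ∑-cong E (λ f → trans (cong (ℤ._*_ ⟦ s f ≟ᶠ u ⟧) (sym (sum-δ (t f) (λ w → M w v)))) (*-distribˡ-sum ⟦ s f ≟ᶠ u ⟧ (λ w → ⟦ t f ≟ᶠ w ⟧ ℤ.* M w v))) ⟩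
    ∑ᴱ (λ f → sum (λ w → ⟦ s f ≟ᶠ u ⟧ ℤ.* (⟦ t f ≟ᶠ w ⟧ ℤ.* M w v)))
      ≡⟨ ∑-sum-swap E n (λ f w → ⟦ s f ≟ᶠ u ⟧ ℤ.* (⟦ t f ≟ᶠ w ⟧ ℤ.* M w v)) ⟩
    sum (λ w → ∑ᴱ (λ f → ⟦ s f ≟ᶠ u ⟧ ℤ.* (⟦ t f ≟ᶠ w ⟧ ℤ.* M w v)))
      ≡⟨ sum-cong-≗ (λ (w : Fin n) → trans (∑-cong E (λ f → sym (ℤ.*-assoc ⟦ s f ≟ᶠ u ⟧ ⟦ t f ≟ᶠ w ⟧ (M w v)))) (sym (*-distribʳ-∑ (M w v) E (λ f → ⟦ s f ≟ᶠ u ⟧ ℤ.* ⟦ t f ≟ᶠ w ⟧)))) ⟩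
    sum (λ w → C 0 u w ℤ.* M w v)
      ≡⟨ ⊗-congʳ M C₀ u v ⟩
    (A ⊗ M) u v
      ∎

  S·-⊖ : {Y : Set} (M N : OEdge X → Y → ℤ) → ∀ u y → (S· λ e y → M e y ℤ.- N e y) u y ≡ (S· M) u y ℤ.- (S· N) u y
  S·-⊖ M N u y = trans (∑-cong E (λ f → lemma ⟦ s f ≟ᶠ u ⟧ (M f y) (N f y))) (∑-⊖ E (λ f → ⟦ s f ≟ᶠ u ⟧ ℤ.* M f y) (λ f → ⟦ s f ≟ᶠ u ⟧ ℤ.* N f y))
    where
    lemma : ∀ a b c → a ℤ.* (b ℤ.- c) ≡ a ℤ.* b ℤ.- a ℤ.* c
    lemma = solve-∀

  S·-cong : {Y : Set} (M N : OEdge X → Y → ℤ) → (∀ e y → M e y ≡ N e y) → ∀ u y → (S· M) u y ≡ (S· N) u y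
  S·-cong M N M≡N u y = ∑-cong E (λ f → cong (ℤ._*_ ⟦ s f ≟ᶠ u ⟧) (M≡N f y))

  -- S (E S - J) Bᵏ E, with S E = A.
  C-suc : ∀ k → C (suc k) ≈ A ⊗ C k ⊖ R k
  C-suc k u v = begin
    (S· Z (suc k)) u v                                   ≡⟨ S·-cong (Z (suc k)) (λ e v → C k (t e) v ℤ.- Z k (op e) v) (B^suc k (incidence t)) u v ⟩
    (S· λ e v → C k (t e) v ℤ.- Z k (op e) v) u v        ≡⟨ S·-⊖ (C k ∘ t) (Z k ∘ op) u v ⟩
    (S· (C k ∘ t)) u v ℤ.- R k u v                       ≡⟨ cong (ℤ._- R k u v) (S·-end (C k) u v) ⟩
    (A ⊗ C k) u v ℤ.- R k u v                            ∎

  -- Regular graphs and the trace recursion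

  module _ (d : ℕ) (regular : Regular X d) where

    -- `M ∘ s` is Sᵀ M, and S Sᵀ is the diagonal matrix of degrees.
    S·-start : (M : Matrix n) → S· (M ∘ s) ≈ (+ d) · M
    S·-start M u v = begin
      ∑ᴱ (λ f → ⟦ s f ≟ᶠ u ⟧ ℤ.* M (s f) v)  ≡⟨ ∑-cong E (λ f → ⟦⟧-subst (s f ≟ᶠ u) (λ w → M w v)) ⟩
      ∑ᴱ (λ f → ⟦ s f ≟ᶠ u ⟧ ℤ.* M u v)      ≡⟨ *-distribʳ-∑ (M u v) E (λ f → ⟦ s f ≟ᶠ u ⟧) ⟨
      ∑ᴱ (λ f → ⟦ s f ≟ᶠ u ⟧) ℤ.* M u v      ≡⟨ cong (ℤ._* M u v) (trans (sym (length-filter (λ f → s f ≟ᶠ u) E)) (cong +_ (regular u))) ⟩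
      + d ℤ.* M u v                            ∎

    row-sum : ∀ u → sum (A u) ≡ + d
    row-sum u = begin
      sum (A u)                                                   ≡⟨ sum-cong-≗ (λ (v : Fin n) → C₀ u v) ⟨
      sum (C 0 u)                                                 ≡⟨ ∑-sum-swap E n (λ f v → ⟦ s f ≟ᶠ u ⟧ ℤ.* ⟦ t f ≟ᶠ v ⟧) ⟨
      ∑ᴱ (λ f → sum (λ v → ⟦ s f ≟ᶠ u ⟧ ℤ.* ⟦ t f ≟ᶠ v ⟧))      ≡⟨ ∑-cong E (λ f → trans (sum-cong-≗ (λ (v : Fin n) → ℤ.*-comm ⟦ s f ≟ᶠ u ⟧ ⟦ t f ≟ᶠ v ⟧)) (sum-δ (t f) (λ _ → ⟦ s f ≟ᶠ u ⟧))) ⟩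
      ∑ᴱ (λ f → ⟦ s f ≟ᶠ u ⟧)                                   ≡⟨ length-filter (λ f → s f ≟ᶠ u) E ⟨
      + degree X u                                                ≡⟨ cong +_ (regular u) ⟩
      + d                                                         ∎

    private
      q′ = + d ℤ.- 1ℤ

    R₀ : R 0 ≈ (+ d) · I
    R₀ u v = trans (S·-cong (incidence t ∘ op) (I ∘ s) (λ e v → cong (λ x → ⟦ x ≟ᶠ v ⟧) (end-op e)) u v) (S·-start I u v)

    -- S J (E S - J) Bᵏ E, with S J E = d I and J J = 1.
    R-suc : ∀ k → R (suc k) ≈ q′ · C k
    R-suc k u v = begin
      (S· (Z (suc k) ∘ op)) u v
        ≡⟨ S·-cong (Z (suc k) ∘ op) (λ e v → C k (s e) v ℤ.- Z k e v) (λ e v → trans (B^suc k (incidence t) (op e) v) (cong₂ (λ x y → C k x v ℤ.- Z k y v) (end-op e) (op-op e))) u v ⟩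
      (S· λ e v → C k (s e) v ℤ.- Z k e v) u v
        ≡⟨ S·-⊖ (C k ∘ s) (Z k) u v ⟩
      (S· (C k ∘ s)) u v ℤ.- C k u v
        ≡⟨ cong (ℤ._- C k u v) (S·-start (C k) u v) ⟩
      + d ℤ.* C k u v ℤ.- C k u v
        ≡⟨ lemma (+ d) (C k u v) ⟩
      (+ d ℤ.- 1ℤ) ℤ.* C k u v
        ∎
      where
      lemma : ∀ a c → a ℤ.* c ℤ.- c ≡ (a ℤ.- 1ℤ) ℤ.* c
      lemma = solve-∀

    C₁ : C 1 ≈ A ⊗ A ⊖ (q′ ℤ.+ 1ℤ) · I
    C₁ u v = begin
      C 1 u v                                  ≡⟨ C-suc 0 u v ⟩
      (A ⊗ C 0) u v ℤ.- R 0 u v                ≡⟨ cong₂ ℤ._-_ (⊗-congˡ A C₀ u v) (R₀ u v) ⟩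
      (A ⊗ A) u v ℤ.- + d ℤ.* I u v            ≡⟨ cong (λ x → (A ⊗ A) u v ℤ.- x ℤ.* I u v) (lemma (+ d)) ⟩
      (A ⊗ A) u v ℤ.- (q′ ℤ.+ 1ℤ) ℤ.* I u v    ∎
      where
      lemma : ∀ x → x ≡ x ℤ.- 1ℤ ℤ.+ 1ℤ
      lemma = solve-∀

    C-rec : ∀ k → C (2 + k) ≈ A ⊗ C (1 + k) ⊖ q′ · C k
    C-rec k u v = trans (C-suc (suc k) u v) (cong (ℤ._-_ ((A ⊗ C (suc k)) u v)) (R-suc k u v))

    -- B Sᵀ = E S Sᵀ - J Sᵀ = d E - E: each oriented edge has d - 1 continuations without
    -- backtracking.
    Y≡qZ : ∀ k e v → (B^ suc k · incidence s) e v ≡ q′ ℤ.* Z k e v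
    Y≡qZ zero e v = begin
      (B^ 1 · incidence s) e v                          ≡⟨ B^suc 0 (incidence s) e v ⟩
      (S· incidence s) (t e) v ℤ.- ⟦ s (op e) ≟ᶠ v ⟧        ≡⟨ cong₂ ℤ._-_ (S·-start I (t e) v) (cong (λ x → ⟦ x ≟ᶠ v ⟧) (start-op e)) ⟩
      + d ℤ.* ⟦ t e ≟ᶠ v ⟧ ℤ.- ⟦ t e ≟ᶠ v ⟧                  ≡⟨ lemma (+ d) ⟦ t e ≟ᶠ v ⟧ ⟩
      q′ ℤ.* ⟦ t e ≟ᶠ v ⟧                                    ∎
      where
      lemma : ∀ a c → a ℤ.* c ℤ.- c ≡ (a ℤ.- 1ℤ) ℤ.* c
      lemma = solve-∀
    Y≡qZ (suc k) e v = begin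
      ∑ᴱ (λ f → ⟦ step? e f ⟧ ℤ.* (B^ suc k · incidence s) f v)  ≡⟨ ∑-cong E (λ f → trans (cong (ℤ._*_ ⟦ step? e f ⟧) (Y≡qZ k f v)) (lemma ⟦ step? e f ⟧ q′ (Z k f v))) ⟩
      ∑ᴱ (λ f → q′ ℤ.* (⟦ step? e f ⟧ ℤ.* Z k f v))                     ≡⟨ *-distribˡ-∑ q′ E (λ f → ⟦ step? e f ⟧ ℤ.* Z k f v) ⟨
      q′ ℤ.* Z (suc k) e v                                                  ∎
      where
      lemma : ∀ a b c → a ℤ.* (b ℤ.* c) ≡ b ℤ.* (a ℤ.* c)
      lemma = solve-∀

    -- N′ k = tr (J Bᵏ)
    N N′ : ℕ → ℤ
    N  k = ∑ᴱ λ e → (B^ k · δ) e e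
    N′ k = ∑ᴱ λ e → (B^ k · δ) (op e) e

    -- tr (E S Bᵏ) = tr (S Bᵏ E) by cyclicity; the J in B contributes N′.
    N-suc : ∀ k → N (suc k) ≡ trace (C k) ℤ.- N′ k
    N-suc k = begin
      N (suc k)
        ≡⟨ ∑-cong E (λ e → B^suc k δ e e) ⟩
      ∑ᴱ (λ e → (S· Bᵏ) (t e) e ℤ.- Bᵏ (op e) e)
        ≡⟨ ∑-⊖ E (λ e → (S· Bᵏ) (t e) e) (λ e → Bᵏ (op e) e) ⟩
      ∑ᴱ (λ e → (S· Bᵏ) (t e) e) ℤ.- N′ k
        ≡⟨ cong (ℤ._- N′ k) (∑-S·δ k t) ⟩
      trace (C k) ℤ.- N′ k
        ∎
      where
      Bᵏ = B^ k · δ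

    -- In J B = J E S - J J the product J E is Sᵀ and J J is 1.
    N′-suc : ∀ k → N′ (suc k) ≡ trace (S· B^ k · incidence s) ℤ.- N k
    N′-suc k = begin
      N′ (suc k)
        ≡⟨ ∑-cong E (λ e → trans (B^suc k δ (op e) e) (cong₂ (λ x y → (S· Bᵏ) x e ℤ.- Bᵏ y e) (end-op e) (op-op e))) ⟩
      ∑ᴱ (λ e → (S· Bᵏ) (s e) e ℤ.- Bᵏ e e)
        ≡⟨ ∑-⊖ E (λ e → (S· Bᵏ) (s e) e) (λ e → Bᵏ e e) ⟩
      ∑ᴱ (λ e → (S· Bᵏ) (s e) e) ℤ.- N k
        ≡⟨ cong (ℤ._- N k) (∑-S·δ k s) ⟩
      trace (S· B^ k · incidence s) ℤ.- N k
        ∎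
      where
      Bᵏ = B^ k · δ

    -- The second power is needed for a factor B next to Sᵀ, which `Y≡qZ` turns into q E.
    N′-suc-suc : ∀ k → N′ (2 + k) ≡ q′ ℤ.* trace (C k) ℤ.- N (suc k)
    N′-suc-suc k = trans (N′-suc (suc k)) (cong (ℤ._- N (suc k)) (begin
      trace (S· B^ suc k · incidence s)                ≡⟨ trace-S· (B^ suc k · incidence s) ⟩
      ∑ᴱ (λ f → (B^ suc k · incidence s) f (s f))    ≡⟨ ∑-cong E (λ f → Y≡qZ k f (s f)) ⟩
      ∑ᴱ (λ f → q′ ℤ.* Z k f (s f))                         ≡⟨ *-distribˡ-∑ q′ E (λ f → Z k f (s f)) ⟨
      q′ ℤ.* ∑ᴱ (λ f → Z k f (s f))                         ≡⟨ cong (ℤ._*_ q′) (trace-S· (Z k)) ⟨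
      q′ ℤ.* trace (C k)                                      ∎))

    N′₀ : N′ 0 ≡ 0ℤ
    N′₀ = trans (∑-cong E (λ e → ⟦⟧-false (op e ≟ᴱ e) (op≢ e))) (sum-0 (length E))

    -- Both tr (S Sᵀ) and tr B⁰ count the oriented edges.
    N′₁ : N′ 1 ≡ 0ℤ
    N′₁ = begin
      N′ 1                                              ≡⟨ N′-suc 0 ⟩
      trace (S· incidence s) ℤ.- N 0                    ≡⟨ cong (ℤ._- N 0) (trace-S· (incidence s)) ⟩
      ∑ᴱ (λ f → ⟦ s f ≟ᶠ s f ⟧) ℤ.- N 0               ≡⟨ cong (ℤ._- N 0) (∑-cong E (λ f → trans (⟦⟧-true (s f ≟ᶠ s f) refl) (sym (⟦⟧-true (f ≟ᴱ f) refl)))) ⟩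
      N 0 ℤ.- N 0                                       ≡⟨ ℤ.+-inverseʳ (N 0) ⟩
      0ℤ                                                ∎

    -- The correction n (q − 1) for even k comes from the eigenvalues ±1 of B.
    N≡ : ∀ k → N (suc k) ≡ (if does (even? (suc k))
                             then + n ℤ.* (q′ ℤ.- 1ℤ) ℤ.+ trace (P A q′ (suc k))
                             else trace (P A q′ (suc k)))
    N≡ zero = begin
      N 1                        ≡⟨ N-suc 0 ⟩
      trace (C 0) ℤ.- N′ 0       ≡⟨ cong₂ ℤ._-_ (trace-cong C₀) N′₀ ⟩
      trace A ℤ.- 0ℤ             ≡⟨ ℤ.+-identityʳ (trace A) ⟩
      trace A                    ∎
    N≡ (suc zero) = begin
      N 2                                                          ≡⟨ N-suc 1 ⟩
      trace (C 1) ℤ.- N′ 1                                         ≡⟨ cong₂ ℤ._-_ (trace-cong C₁) N′₁ ⟩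
      trace (A ⊗ A ⊖ (q′ ℤ.+ 1ℤ) · I) ℤ.- 0ℤ                       ≡⟨ cong (ℤ._- 0ℤ) (trans (sum-⊖ (λ u → (A ⊗ A) u u) (λ u → (q′ ℤ.+ 1ℤ) ℤ.* I u u)) (cong (ℤ._-_ (trace (A ⊗ A))) (trace-·I {n} (q′ ℤ.+ 1ℤ)))) ⟩
      trace (A ⊗ A) ℤ.- + n ℤ.* (q′ ℤ.+ 1ℤ) ℤ.- 0ℤ                 ≡⟨ lemma (trace (A ⊗ A)) (+ n) q′ ⟩
      + n ℤ.* (q′ ℤ.- 1ℤ) ℤ.+ (trace (A ⊗ A) ℤ.- q′ ℤ.* (+ n ℤ.* + 2)) ≡⟨ cong (ℤ._+_ (+ n ℤ.* (q′ ℤ.- 1ℤ))) trace-P₂ ⟨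
      + n ℤ.* (q′ ℤ.- 1ℤ) ℤ.+ trace (P A q′ 2)                     ∎
      where
      trace-P₂ : trace (P A q′ 2) ≡ trace (A ⊗ A) ℤ.- q′ ℤ.* (+ n ℤ.* + 2)
      trace-P₂ = trans (sum-⊖ (λ u → (A ⊗ A) u u) (λ u → q′ ℤ.* (+ 2 ℤ.* I u u))) (cong (ℤ._-_ (trace (A ⊗ A)))
        (trans (sym (*-distribˡ-sum q′ (λ (u : Fin n) → + 2 ℤ.* I u u))) (cong (ℤ._*_ q′) (trace-·I {n} (+ 2)))))
      lemma : ∀ x n q → x ℤ.- n ℤ.* (q ℤ.+ 1ℤ) ℤ.- 0ℤ ≡ n ℤ.* (q ℤ.- 1ℤ) ℤ.+ (x ℤ.- q ℤ.* (n ℤ.* + 2))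
      lemma = solve-∀
    N≡ (suc (suc k)) = begin
      N (3 + k)
        ≡⟨ trans (N-suc (2 + k)) (cong (ℤ._-_ (trace (C (2 + k)))) (N′-suc-suc k)) ⟩
      trace (C (2 + k)) ℤ.- (q′ ℤ.* trace (C k) ℤ.- N (suc k))
        ≡⟨ cong (λ x → x ℤ.- (q′ ℤ.* trace (C k) ℤ.- N (suc k))) trace-C ⟩
      (τ (3 + k) ℤ.- τ (1 + k) ℤ.+ q′ ℤ.* trace (C k)) ℤ.- (q′ ℤ.* trace (C k) ℤ.- N (suc k))
        ≡⟨ cong (λ x → (τ (3 + k) ℤ.- τ (1 + k) ℤ.+ q′ ℤ.* trace (C k)) ℤ.- (q′ ℤ.* trace (C k) ℤ.- x)) (N≡ k) ⟩
      (τ (3 + k) ℤ.- τ (1 + k) ℤ.+ q′ ℤ.* trace (C k)) ℤ.- (q′ ℤ.* trace (C k) ℤ.- result b (τ (1 + k)))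
        ≡⟨ cancel b (τ (3 + k)) (τ (1 + k)) (q′ ℤ.* trace (C k)) ⟩
      result b (τ (3 + k))
        ∎
      where
      -- The remainder modulo 2 recurs after two successors by computation, so this is also the
      -- parity bit of 3 + k and the correction cancels without a case distinction on k.
      b = does (even? (suc k))
      τ : ℕ → ℤ
      τ k = trace (P A q′ k)
      result : Bool → ℤ → ℤ
      result b x = if b then + n ℤ.* (q′ ℤ.- 1ℤ) ℤ.+ x else x
      trace-C : trace (C (2 + k)) ≡ τ (3 + k) ℤ.- τ (1 + k) ℤ.+ q′ ℤ.* trace (C k)
      trace-C = begin
        trace (C (2 + k))
          ≡⟨ trace-cong (C-via-P A q′ C C₀ C₁ C-rec k) ⟩
        trace (P A q′ (3 + k) ⊖ P A q′ (1 + k) ⊕ q′ · C k)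
          ≡⟨ sum-lin (λ u → P A q′ (3 + k) u u ℤ.- P A q′ (1 + k) u u) (λ u → C k u u) q′ ⟩
        trace (P A q′ (3 + k) ⊖ P A q′ (1 + k)) ℤ.+ q′ ℤ.* trace (C k)
          ≡⟨ cong (ℤ._+ q′ ℤ.* trace (C k)) (sum-⊖ (λ u → P A q′ (3 + k) u u) (λ u → P A q′ (1 + k) u u)) ⟩
        τ (3 + k) ℤ.- τ (1 + k) ℤ.+ q′ ℤ.* trace (C k)
          ∎
      cancel : ∀ b x y z → (x ℤ.- y ℤ.+ z) ℤ.- (z ℤ.- result b y) ≡ result b x
      cancel true  x y z = lemma x y z (+ n ℤ.* (q′ ℤ.- 1ℤ))
        where
        lemma : ∀ x y z c → (x ℤ.- y ℤ.+ z) ℤ.- (z ℤ.- (c ℤ.+ y)) ≡ c ℤ.+ x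
        lemma = solve-∀
      cancel false x y z = lemma x y z
        where
        lemma : ∀ x y z → (x ℤ.- y ℤ.+ z) ℤ.- (z ℤ.- y) ≡ x
        lemma = solve-∀

theorem2p4 : (q n : ℕ) → 1 ≤ q → 2 ≤ n →
    (X : Graph n) → Connected X → Regular X (q + 1) →
    (k : ℕ) → .{{_ : NonZero k}} →
    (u : Unspecified n) →
    NGC (adjacency X) k u ≡ + (#geodesicCycles X k)
theorem2p4 q n _ _ X _ regular k@(suc k-1) u = begin
  NGC (adjacency X) k u
    ≡⟨ NGC≡ (adjacency X) k u (s≤s z≤n) ⟩
  result q′
    -- Every row sum is the common degree, whichever row `u` selects.
    ≡⟨ cong (λ x → result (x ℤ.- 1ℤ)) (row-sum X (q + 1) regular (Unspecified.row u)) ⟩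
  result (+ (q + 1) ℤ.- 1ℤ)
    ≡⟨ N≡ X (q + 1) regular k-1 ⟨
  N X (q + 1) regular k
    ≡⟨ #geodesicCycles≡ X k ⟨
  + #geodesicCycles X k
    ∎
  where
  q′ = Defs.q (adjacency X) k u
  result : ℤ → ℤ
  result q = if does (even? k) then + n ℤ.* (q ℤ.- 1ℤ) ℤ.+ trace (P (adjacency X) q k) else trace (P (adjacency X) q k)
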